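{- Let $V$ be a vector space over the finite field $\mathbb{F}_q$ with basis $\{b_1,\dots,b_n\}$, and let $\mathcal{X}=(X_1,\dots,X_k)$ be a family of subspaces of $V$ such that each $X_i=\langle b_j : j\in L_i\rangle$ for some set $L_i\subseteq\{1,\dots,n\}$. Then the $q$-transversal matroid associated with $\mathcal{X}$ (the $q$-matroid whose independent subspaces are the partial $q$-transversals of $\mathcal{X}$) is representable.
   Context: A partial $q$-transversal of $\mathcal{X}$ is a subspace $T\le V$ such that every vector basis $B$ of $T$ admits an injection $\pi:B\to\{1,\dots,k\}$ with $b\notin X_{\pi(b)}$ for all $b\in B$; these form the independent subspaces of a $q$-matroid on $V$ (rank function $r$ with $0\le r(A)\le\dim A$, monotone, submodular; independent means $r(A)=\dim A$). Identify $V$ with $\mathbb{F}_q^n$ via the basis $b_1,\dots,b_n$. A $q$-matroid on $\mathbb{F}_q^n$ is representable if there is a field $K\supseteq\mathbb{F}_q$ and a matrix $G$ over $K$ with $n$ columns such that for every subspace $U$, if $U$ is the row space of a matrix $X$ over $\mathbb{F}_q$, then the rank of $U$ in the $q$-matroid equals the rank of the matrix $GX^T$. -}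

module Defs where

open import Level using (Level; _⊔_) renaming (suc to lsuc)
open import Algebra.Bundles using (CommutativeRing)
open import Algebra.Morphism.Structures using (module RingMorphisms)
open import Data.Nat using (ℕ; zero; suc; _≤_)
open import Data.Fin using (Fin; zero; suc)
import Data.Fin
open import Data.Fin.Subset using (Subset; _∉_)
open import Data.Product using (Σ; ∃; _×_; _,_)
open import Function.Definitions using (Injective)
open import Relation.Nullary using (¬_; yes; no)
open import Relation.Binary.PropositionalEquality using (_≡_)
open import Relation.Binary.Definitions using (Decidable)

record Field (c ℓ : Level) : Set (lsuc (c ⊔ ℓ)) where
  field
    commutativeRing : CommutativeRing c ℓ
  open CommutativeRing commutativeRing public
  field
    1≉0     : ¬ (1# ≈ 0#)
    inverse : ∀ x → ¬ (x ≈ 0#) → ∃ λ y → (x * y) ≈ 1#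

record FiniteField (c ℓ : Level) : Set (lsuc (c ⊔ ℓ)) where
  field
    field′ : Field c ℓ
  open Field field′ public
  field
    _≟_   : Decidable _≈_
    q     : ℕ
    enum  : Fin q → Carrier
    enum-surjective : ∀ x → ∃ λ i → enum i ≈ x

module LinAlg {c ℓ : Level} (R : CommutativeRing c ℓ) where
  open CommutativeRing R using (Carrier; _≈_; _+_; _*_; 0#; 1#)

  Vect : ℕ → Set c
  Vect n = Fin n → Carrier

  ∑ : ∀ {m} → (Fin m → Carrier) → Carrier
  ∑ {zero}  f = 0#
  ∑ {suc m} f = f zero + ∑ (λ i → f (suc i))

  _≈ᵛ_ : ∀ {n} → Vect n → Vect n → Set ℓ
  v ≈ᵛ w = ∀ j → v j ≈ w j

  0ᵛ : ∀ {n} → Vect n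
  0ᵛ _ = 0#

  lincomb : ∀ {m n} → (Fin m → Carrier) → (Fin m → Vect n) → Vect n
  lincomb c v j = ∑ (λ i → c i * v i j)

  LinIndep : ∀ {m n} → (Fin m → Vect n) → Set (c ⊔ ℓ)
  LinIndep v = ∀ a → lincomb a v ≈ᵛ 0ᵛ → ∀ i → a i ≈ 0#

  InSpan : ∀ {m n} → Vect n → (Fin m → Vect n) → Set (c ⊔ ℓ)
  InSpan v X = ∃ λ a → v ≈ᵛ lincomb a X

  SubSpan : ∀ {s m n} → (Fin s → Vect n) → (Fin m → Vect n) → Set (c ⊔ ℓ)
  SubSpan Y X = ∀ t → InSpan (Y t) X

  IsBasisOf : ∀ {d m n} → (Fin d → Vect n) → (Fin m → Vect n) → Set (c ⊔ ℓ)
  IsBasisOf B X = LinIndep B × SubSpan B X × SubSpan X B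

  HasDim : ∀ {m n} → (Fin m → Vect n) → ℕ → Set (c ⊔ ℓ)
  HasDim {n = n} X d = Σ (Fin d → Vect n) λ B → IsBasisOf B X

  column : ∀ {m p} → (Fin m → Fin p → Carrier) → Fin p → Vect m
  column M j a = M a j

  MatRank : ∀ {m p} → (Fin m → Fin p → Carrier) → ℕ → Set (c ⊔ ℓ)
  MatRank {p = p} M r =
    (Σ (Fin r → Fin p) λ σ → LinIndep (λ t → column M (σ t)))
    × (∀ s (σ : Fin s → Fin p) → LinIndep (λ t → column M (σ t)) → s ≤ r)

module QTransversal {c ℓ : Level} (F : FiniteField c ℓ) where
  open FiniteField F using (Carrier; _≈_; 0#; 1#; commutativeRing)
  open LinAlg commutativeRing

  e : ∀ {n} → Fin n → Vect n
  e j j′ with Data.Fin._≟_ j j′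
  ... | yes _ = 1#
  ... | no  _ = 0#

  InCoordSpan : ∀ {n} → Subset n → Vect n → Set (c ⊔ ℓ)
  InCoordSpan {n} L v =
    Σ (Fin n → Carrier) λ a → (∀ j → j ∉ L → a j ≈ 0#) × (v ≈ᵛ lincomb a e)

  -- The subspace T = ⟨Y⟩ is a partial q-transversal of X = (X_1..X_k),
  -- X_i = ⟨ b_j : j ∈ L i ⟩.
  PartialTransversal : ∀ {n k s} → (Fin k → Subset n) → (Fin s → Vect n) → Set (c ⊔ ℓ)
  PartialTransversal {n} {k} L Y =
    ∀ d (B : Fin d → Vect n) → IsBasisOf B Y →
      Σ (Fin d → Fin k) λ π → Injective _≡_ _≡_ π
        × (∀ b → ¬ InCoordSpan (L (π b)) (B b))

  QTRank : ∀ {n k p} → (Fin k → Subset n) → (Fin p → Vect n) → ℕ → Set (c ⊔ ℓ)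
  QTRank {n} L X r =
    (∃ λ s → Σ (Fin s → Vect n) λ Y →
        SubSpan Y X × PartialTransversal L Y × HasDim Y r)
    × (∀ s (Y : Fin s → Vect n) d →
        SubSpan Y X → PartialTransversal L Y → HasDim Y d → d ≤ r)

-- Representability of a q-matroid on F^n given by its rank relation
-- ρ X r  ("the subspace spanned by the rows of X has rank r")

module _ {c ℓ : Level} (F : FiniteField c ℓ) where
  private
    module F = FiniteField F

  Representable : (n : ℕ) →
    (∀ {p} → (Fin p → Fin n → F.Carrier) → ℕ → Set (c ⊔ ℓ)) → Set (lsuc (c ⊔ ℓ))
  Representable n ρ =
    Σ (Field c ℓ) λ K →
      let module K = Field K in
      Σ (F.Carrier → K.Carrier) λ ι →
        RingMorphisms.IsRingHomomorphism F.rawRing K.rawRing ι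
        × Injective F._≈_ K._≈_ ι
        × (∃ λ m → Σ (Fin m → Fin n → K.Carrier) λ G →
             ∀ p (X : Fin p → Fin n → F.Carrier) →
               ∃ λ r → ρ X r
                 × LinAlg.MatRank K.commutativeRing
                     (λ a t → LinAlg.∑ K.commutativeRing
                                (λ j → G a j K.* ι (X t j))) r)

{-# OPTIONS --safe #-}

-- The representing matrix G has a zero at (i , j) if j ∈ L i; its other entries are generic,
-- in the following weak sense.  The field is built as a tower, one step K ⊂ K(t) per row, and
-- the entries of the new row are the powers of t, hence linearly independent over the field K
-- that contains the previous rows.
--
-- If the columns G b, for b in a basis B of T, are linearly independent, a transversal of nonzero
-- entries of the matrix (G b) gives the injection π, so T is a partial q-transversal.  Conversely,
-- by induction on the rows: if the kernel of G on T ⊗ K has dimension m, then some W ≤ T has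
-- dim W ≥ m + #{ i : W ⊄ X i }.  Indeed, either the new row cuts the kernel down by one
-- dimension, and W is kept, or it vanishes on the kernel; by independence of its entries the
-- kernel then lies in X i ⊗ K, and W can be chosen inside T ∩ X i.  If m > 0, a basis of T
-- extending one of W admits no injection π.
module Submission where

open import Defs
open import Level using (Level; _⊔_) renaming (suc to lsuc)
open import Algebra.Bundles using (AbelianGroup; CommutativeRing; RawRing)
open import Algebra.Morphism.Structures using (module RingMorphisms)
import Algebra.Construct.Pointwise as Pointwise
import Algebra.Morphism.Construct.Composition as Composition
import Algebra.Morphism.Construct.Identity as Identity
import Algebra.Morphism.RingMonomorphism as RingMonomorphism
import Algebra.Properties.CommutativeSemigroup as CommutativeSemigroupProperties
import Algebra.Properties.Group as GroupProperties
import Algebra.Properties.Ring as RingProperties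
import Algebra.Solver.Ring.NaturalCoefficients.Default as SemiringSolver
open import Data.Empty using (⊥-elim)
open import Data.Fin as Fin using (Fin; zero; suc; toℕ; punchIn; punchOut)
open import Data.Fin.Properties using (all?; ¬∀⟶∃¬; injective⇒≤; punchIn-punchOut; suc-injective)
open import Data.Fin.Subset using (Subset; _∈_; _∉_)
open import Data.Fin.Subset.Properties using (_∈?_)
open import Data.List using (List; []; _∷_; map)
open import Data.Nat as ℕ using (ℕ; zero; suc; _≤_; s≤s)
import Data.Nat.Properties as ℕₚ
open import Data.Product using (Σ; ∃; ∃₂; _×_; _,_; proj₁; proj₂)
open import Data.Sum as Sum using (_⊎_; inj₁; inj₂)
open import Data.Vec.Functional using (insertAt) renaming ([] to []ᵛ; _∷_ to _∷ᵛ_)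
open import Data.Vec.Functional.Properties using (insertAt-lookup; insertAt-punchIn)
open import Function using (_∘_; id)
open import Function.Definitions using (Injective)
open import Relation.Binary.Definitions using (Decidable)
open import Relation.Binary.PropositionalEquality as ≡ using (_≡_)
import Relation.Binary.Reasoning.Setoid as SetoidReasoning
open import Relation.Nullary using (¬_; Dec; yes; no; contradiction)
open import Relation.Nullary.Decidable using (False; fromWitnessFalse; toWitnessFalse; map′)

-- The kernel of `G` on `T ⊗ K` may contain no nonzero vector of `T`, so a relation among the
-- columns `G b` does not itself show which basis of `T` is bad; the subspace `W`, defined over the
-- ground field, is what can be recovered from it. Two descents make this possible. The kernel of
-- the earlier rows has a basis with entries in `K`, which still spans it over `K(t)`; at a vector
-- over `K`, the new row vanishes only if all coordinates outside `L i` do. And `T ∩ X i` is cut out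
-- by equations over the ground field, so forming it commutes with extension of scalars. Both
-- descents are Gaussian elimination with pivots in the smaller field, which requires deciding
-- whether an element is zero. Hence every field of the tower carries decidable equality, and `K(t)`
-- consists of explicit fractions of coefficient lists.

record DiscreteField (c ℓ : Level) : Set (lsuc (c ⊔ ℓ)) where
  field
    field′ : Field c ℓ
  open Field field′ public
  field
    _≟_ : Decidable _≈_

-- Homomorphisms of commutative rings

RingHom : ∀ {c ℓ c′ ℓ′} (R : CommutativeRing c ℓ) (S : CommutativeRing c′ ℓ′) →
          (CommutativeRing.Carrier R → CommutativeRing.Carrier S) → Set _
RingHom R S = RingMorphisms.IsRingHomomorphism (CommutativeRing.rawRing R) (CommutativeRing.rawRing S)

mkRingHom : ∀ {c ℓ c′ ℓ′} (R : CommutativeRing c ℓ) (S : CommutativeRing c′ ℓ′)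
  (let module R = CommutativeRing R; module S = CommutativeRing S) (f : R.Carrier → S.Carrier) →
  (∀ {x y} → x R.≈ y → f x S.≈ f y) →
  (∀ x y → f (x R.+ y) S.≈ (f x S.+ f y)) →
  (∀ x y → f (x R.* y) S.≈ (f x S.* f y)) →
  f R.1# S.≈ S.1# → RingHom R S f
mkRingHom R S f cong +-homo *-homo 1-homo = record
  { isSemiringHomomorphism = record
    { isNearSemiringHomomorphism = record
      { +-isMonoidHomomorphism = record
        { isMagmaHomomorphism = record
          { isRelHomomorphism = record { cong = cong } ; homo = +-homo }
        ; ε-homo = 0-homo }
      ; *-homo = *-homo }
    ; 1#-homo = 1-homo }
  ; -‿homo = λ x → GroupProperties.inverseˡ-unique S.+-group (f (R.- x)) (f x)
      (S.trans (S.sym (+-homo (R.- x) x)) (S.trans (cong (R.-‿inverseˡ x)) 0-homo)) }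
  where
  module R = CommutativeRing R
  module S = CommutativeRing S
  0-homo : f R.0# S.≈ S.0#
  0-homo = GroupProperties.identityʳ-unique S.+-group (f R.0#) (f R.0#)
    (S.trans (S.sym (+-homo R.0# R.0#)) (cong (R.+-identityˡ R.0#)))

-- Sums, linear combinations and coordinate vectors over a commutative ring

module Sums {c ℓ : Level} (R : CommutativeRing c ℓ) where
  open CommutativeRing R hiding (zero)
  open LinAlg R
  open SetoidReasoning setoid
  open CommutativeSemigroupProperties +-commutativeSemigroup using (interchange; x∙yz≈y∙xz)

  ∑-cong : ∀ {m} {f g : Fin m → Carrier} → (∀ i → f i ≈ g i) → ∑ f ≈ ∑ g
  ∑-cong {zero}  f≈g = refl
  ∑-cong {suc m} f≈g = +-cong (f≈g zero) (∑-cong (f≈g ∘ suc))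

  ∑-zero : ∀ {m} {f : Fin m → Carrier} → (∀ i → f i ≈ 0#) → ∑ f ≈ 0#
  ∑-zero {zero}  f≈0 = refl
  ∑-zero {suc m} f≈0 = trans (+-cong (f≈0 zero) (∑-zero (f≈0 ∘ suc))) (+-identityˡ 0#)

  ∑-+ : ∀ {m} (f g : Fin m → Carrier) → ∑ (λ i → f i + g i) ≈ ∑ f + ∑ g
  ∑-+ {zero}  f g = sym (+-identityˡ 0#)
  ∑-+ {suc m} f g = trans (+-congˡ (∑-+ (f ∘ suc) (g ∘ suc))) (interchange _ _ _ _)

  *-∑ : ∀ {m} x (f : Fin m → Carrier) → x * ∑ f ≈ ∑ (λ i → x * f i)
  *-∑ {zero}  x f = zeroʳ x
  *-∑ {suc m} x f = trans (distribˡ x _ _) (+-congˡ (*-∑ x (f ∘ suc)))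

  ∑-* : ∀ {m} x (f : Fin m → Carrier) → ∑ f * x ≈ ∑ (λ i → f i * x)
  ∑-* x f = trans (*-comm _ x) (trans (*-∑ x f) (∑-cong λ i → *-comm x (f i)))

  ∑-swap : ∀ {m n} (f : Fin m → Fin n → Carrier) →
           ∑ (λ i → ∑ (f i)) ≈ ∑ (λ j → ∑ (λ i → f i j))
  ∑-swap {zero} {n} f = sym (∑-zero {n} λ _ → refl)
  ∑-swap {suc m} f = trans (+-congˡ (∑-swap (f ∘ suc))) (sym (∑-+ (f zero) _))

  ∑-remove : ∀ {m} (i : Fin (suc m)) (f : Fin (suc m) → Carrier) →
             ∑ f ≈ f i + ∑ (f ∘ punchIn i)
  ∑-remove zero f = refl
  ∑-remove {suc m} (suc i) f = trans (+-congˡ (∑-remove i (f ∘ suc))) (x∙yz≈y∙xz _ _ _)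

  -- Recursion on both indices, unlike the decision in `e`, lets sums against `δ` be evaluated by
  -- induction and computation.
  δ : ∀ {m} → Fin m → Vect m
  δ zero    zero    = 1#
  δ zero    (suc j) = 0#
  δ (suc i) zero    = 0#
  δ (suc i) (suc j) = δ i j

  δ-diag : ∀ {m} (i : Fin m) → δ i i ≈ 1#
  δ-diag zero    = refl
  δ-diag (suc i) = δ-diag i

  δ-off : ∀ {m} {i j : Fin m} → ¬ (i ≡ j) → δ i j ≈ 0#
  δ-off {i = zero}  {zero}  i≢j = contradiction ≡.refl i≢j
  δ-off {i = zero}  {suc j} i≢j = refl
  δ-off {i = suc i} {zero}  i≢j = refl
  δ-off {i = suc i} {suc j} i≢j = δ-off (i≢j ∘ ≡.cong suc)

  ∑-δ : ∀ {m} (a : Fin m → Carrier) → lincomb a δ ≈ᵛ a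
  ∑-δ {suc m} a zero = begin
    a zero * 1# + ∑ (λ i → a (suc i) * 0#) ≈⟨ +-cong (*-identityʳ _) (∑-zero {m} λ i → zeroʳ _) ⟩
    a zero + 0#                            ≈⟨ +-identityʳ _ ⟩
    a zero                                 ∎
  ∑-δ a (suc j) = begin
    a zero * 0# + lincomb (a ∘ suc) δ j ≈⟨ +-cong (zeroʳ _) (∑-δ (a ∘ suc) j) ⟩
    0# + a (suc j)                      ≈⟨ +-identityˡ _ ⟩
    a (suc j)                           ∎

  δ-∑ : ∀ {m n} (v : Fin m → Vect n) i → lincomb (δ i) v ≈ᵛ v i
  δ-∑ {suc m} v zero j = begin
    1# * v zero j + ∑ (λ i → 0# * v (suc i) j) ≈⟨ +-cong (*-identityˡ _) (∑-zero {m} λ i → zeroˡ _) ⟩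
    v zero j + 0#                              ≈⟨ +-identityʳ _ ⟩
    v zero j                                   ∎
  δ-∑ v (suc i) j = begin
    0# * v zero j + lincomb (δ i) (v ∘ suc) j ≈⟨ +-cong (zeroˡ _) (δ-∑ (v ∘ suc) i j) ⟩
    0# + v (suc i) j                          ≈⟨ +-identityˡ _ ⟩
    v (suc i) j                               ∎

  lincomb-cong : ∀ {m n} {a b : Fin m → Carrier} {v w : Fin m → Vect n} →
    (∀ i → a i ≈ b i) → (∀ i → v i ≈ᵛ w i) → lincomb a v ≈ᵛ lincomb b w
  lincomb-cong a≈b v≈w j = ∑-cong λ i → *-cong (a≈b i) (v≈w i j)

  lincomb-zero : ∀ {m n} {a : Fin m → Carrier} {v : Fin m → Vect n} →
    (∀ i → a i ≈ 0#) → lincomb a v ≈ᵛ 0ᵛ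
  lincomb-zero a≈0 j = ∑-zero λ i → trans (*-congʳ (a≈0 i)) (zeroˡ _)

  lincomb-assoc : ∀ {m l n} (a : Fin m → Carrier) (A : Fin m → Vect l) (v : Fin l → Vect n) →
    lincomb a (λ i → lincomb (A i) v) ≈ᵛ lincomb (lincomb a A) v
  lincomb-assoc {m} {l} a A v j = begin
    ∑ (λ i → a i * ∑ (λ t → A i t * v t j))     ≈⟨ ∑-cong (λ i → *-∑ (a i) (λ t → A i t * v t j)) ⟩
    ∑ (λ i → ∑ (λ t → a i * (A i t * v t j)))   ≈⟨ ∑-swap (λ i t → a i * (A i t * v t j)) ⟩
    ∑ (λ t → ∑ (λ i → a i * (A i t * v t j)))   ≈⟨ ∑-cong (λ t → ∑-cong {m} λ i → *-assoc (a i) (A i t) (v t j)) ⟨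
    ∑ (λ t → ∑ (λ i → a i * A i t * v t j))     ≈⟨ ∑-cong (λ t → ∑-* (v t j) (λ i → a i * A i t)) ⟨
    ∑ (λ t → ∑ (λ i → a i * A i t) * v t j)     ∎

  lincomb-linear : ∀ {m n} s t (a b : Fin m → Carrier) (v : Fin m → Vect n) j →
    lincomb (λ i → s * a i + t * b i) v j ≈ s * lincomb a v j + t * lincomb b v j
  lincomb-linear {m} s t a b v j = begin
    ∑ (λ i → (s * a i + t * b i) * v i j)
      ≈⟨ ∑-cong {m} (λ i → trans (distribʳ _ _ _) (+-cong (*-assoc _ _ _) (*-assoc _ _ _))) ⟩
    ∑ (λ i → s * (a i * v i j) + t * (b i * v i j))
      ≈⟨ ∑-+ (λ i → s * (a i * v i j)) (λ i → t * (b i * v i j)) ⟩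
    ∑ (λ i → s * (a i * v i j)) + ∑ (λ i → t * (b i * v i j))
      ≈⟨ +-cong (*-∑ s (λ i → a i * v i j)) (*-∑ t (λ i → b i * v i j)) ⟨
    s * lincomb a v j + t * lincomb b v j ∎

  lincomb-insertAt : ∀ {m n} (a : Fin m → Carrier) i x (v : Fin (suc m) → Vect n) j →
    lincomb (insertAt a i x) v j ≈ x * v i j + lincomb a (v ∘ punchIn i) j
  lincomb-insertAt a i x v j = trans (∑-remove i (λ l → insertAt a i x l * v l j)) (+-cong
    (*-congʳ (reflexive (insertAt-lookup a i x)))
    (∑-cong λ l → *-congʳ (reflexive (insertAt-punchIn a i x l))))

  image : ∀ {k n} → (Fin k → Vect n) → Vect n → Vect k
  image G x i = ∑ (λ j → G i j * x j)

  image-cong : ∀ {k n} (G : Fin k → Vect n) {x y : Vect n} → x ≈ᵛ y → image G x ≈ᵛ image G y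
  image-cong G x≈y i = ∑-cong λ j → *-congˡ (x≈y j)

  image-lincomb : ∀ {k m n} (G : Fin k → Vect n) (a : Fin m → Carrier) (v : Fin m → Vect n) →
    image G (lincomb a v) ≈ᵛ lincomb a (λ i → image G (v i))
  image-lincomb G a v i = begin
    ∑ (λ j → G i j * lincomb a v j)                     ≈⟨ ∑-cong (λ j → *-comm (G i j) _) ⟩
    lincomb (lincomb a v) (λ j i → G i j) i             ≈⟨ lincomb-assoc a v (λ j i → G i j) i ⟨
    lincomb a (λ l → lincomb (v l) (λ j i → G i j)) i   ≈⟨ ∑-cong (λ l → *-congˡ (∑-cong λ j → *-comm (v l j) (G i j))) ⟩
    lincomb a (λ l → image G (v l)) i                   ∎

  coordinates-indep : ∀ {m l n} {v : Fin m → Vect n} (A : Fin m → Vect l) (w : Fin l → Vect n) →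
    (∀ i → v i ≈ᵛ lincomb (A i) w) → LinIndep v → LinIndep A
  coordinates-indep A w v≈Aw v-indep a aA≈0 = v-indep a λ j →
    trans (lincomb-cong (λ _ → refl) v≈Aw j)
      (trans (lincomb-assoc a A w j) (lincomb-zero {v = w} aA≈0 j))

  lincomb-indep : ∀ {m l n} (A : Fin m → Vect l) (w : Fin l → Vect n) →
    LinIndep A → LinIndep w → LinIndep (λ i → lincomb (A i) w)
  lincomb-indep A w A-indep w-indep a aAw≈0 = A-indep a
    (w-indep (lincomb a A) λ j → trans (sym (lincomb-assoc a A w j)) (aAw≈0 j))

  InSpan-trans : ∀ {m l n} {x : Vect n} {v : Fin m → Vect n} {w : Fin l → Vect n} →
    InSpan x v → SubSpan v w → InSpan x w
  InSpan-trans {v = v} {w} (a , x≈av) v⊆w = lincomb a A , λ j →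
    trans (x≈av j) (trans (lincomb-cong (λ _ → refl) (λ i → proj₂ (v⊆w i)) j) (lincomb-assoc a A w j))
    where A = λ i → proj₁ (v⊆w i)

  ∈-span : ∀ {m n} (v : Fin m → Vect n) i → InSpan (v i) v
  ∈-span v i = δ i , λ j → sym (δ-∑ v i j)

  coordinates-unique : ∀ {m n} {v : Fin m → Vect n} → LinIndep v →
    ∀ {a b} → lincomb a v ≈ᵛ lincomb b v → ∀ i → a i ≈ b i
  coordinates-unique {v = v} v-indep {a} {b} av≈bv i = begin
    a i                            ≈⟨ *-identityˡ _ ⟨
    1# * a i                       ≈⟨ GroupProperties.inverseˡ-unique +-group _ _ (v-indep _ relation i) ⟩
    - (- 1# * b i)                 ≈⟨ -‿cong (-1*x≈-x (b i)) ⟩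
    - - b i                        ≈⟨ -‿involutive (b i) ⟩
    b i                            ∎
    where
    open RingProperties ring using (-1*x≈-x; -‿involutive)
    relation : lincomb (λ i → 1# * a i + - 1# * b i) v ≈ᵛ 0ᵛ
    relation j = begin
      lincomb (λ i → 1# * a i + - 1# * b i) v j    ≈⟨ lincomb-linear 1# (- 1#) a b v j ⟩
      1# * lincomb a v j + - 1# * lincomb b v j    ≈⟨ +-cong (*-identityˡ _) (-1*x≈-x _) ⟩
      lincomb a v j + - lincomb b v j              ≈⟨ +-congʳ (av≈bv j) ⟩
      lincomb b v j + - lincomb b v j              ≈⟨ -‿inverseʳ _ ⟩
      0#                                           ∎

  -- The projection along the coordinate subspace of `L`, which is its kernel: membership in the
  -- subspace becomes the vanishing of a vector.
  restrict : ∀ {n} → Subset n → Vect n → Vect n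
  restrict L v j with j ∈? L
  ... | yes _ = 0#
  ... | no  _ = v j

  restrict-∈ : ∀ {n} {L : Subset n} (v : Vect n) {j} → j ∈ L → restrict L v j ≡ 0#
  restrict-∈ {L = L} v {j} j∈L with j ∈? L
  ... | yes _   = ≡.refl
  ... | no  j∉L = contradiction j∈L j∉L

  restrict-∉ : ∀ {n} {L : Subset n} (v : Vect n) {j} → j ∉ L → restrict L v j ≡ v j
  restrict-∉ {L = L} v {j} j∉L with j ∈? L
  ... | yes j∈L = contradiction j∈L j∉L
  ... | no  _   = ≡.refl

  lincomb-restrict : ∀ {m n} (L : Subset n) (a : Fin m → Carrier) (v : Fin m → Vect n) →
    lincomb a (λ i → restrict L (v i)) ≈ᵛ restrict L (lincomb a v)
  lincomb-restrict L a v j with j ∈? L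
  ... | yes _ = ∑-zero λ i → zeroʳ (a i)
  ... | no  _ = refl

module FieldProperties {c ℓ : Level} (K : Field c ℓ) where
  open Field K
  open SetoidReasoning setoid

  field-cancel : ∀ {x y} → ¬ (x ≈ 0#) → x * y ≈ 0# → y ≈ 0#
  field-cancel {x} {y} x≉0 xy≈0 = begin
    y              ≈⟨ *-identityˡ y ⟨
    1# * y         ≈⟨ *-congʳ (proj₂ (inverse x x≉0)) ⟨
    x * x⁻¹ * y    ≈⟨ *-congʳ (*-comm x x⁻¹) ⟩
    x⁻¹ * x * y    ≈⟨ *-assoc x⁻¹ x y ⟩
    x⁻¹ * (x * y)  ≈⟨ *-congˡ xy≈0 ⟩
    x⁻¹ * 0#       ≈⟨ zeroʳ x⁻¹ ⟩
    0#             ∎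
    where x⁻¹ = proj₁ (inverse x x≉0)

-- Formal power series

module PowerSeries {c ℓ : Level} (R : CommutativeRing c ℓ) where
  open CommutativeRing R hiding (zero)
  open SetoidReasoning setoid
  open SemiringSolver commutativeSemiring using (solve; _:=_; _:+_; _:*_)

  infixl 7 _⊛_
  -- The Cauchy product, unrolled along the left factor so that no sum over pairs of indices has to
  -- be formed.
  _⊛_ : (ℕ → Carrier) → (ℕ → Carrier) → ℕ → Carrier
  (f ⊛ g) zero    = f zero * g zero
  (f ⊛ g) (suc n) = f zero * g (suc n) + ((f ∘ suc) ⊛ g) n

  0ˢ 1ˢ : ℕ → Carrier
  0ˢ _       = 0#
  1ˢ zero    = 1#
  1ˢ (suc _) = 0#

  ⊛-cong : ∀ {f f′ g g′} → (∀ n → f n ≈ f′ n) → (∀ n → g n ≈ g′ n) → ∀ n → (f ⊛ g) n ≈ (f′ ⊛ g′) n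
  ⊛-cong p q zero    = *-cong (p zero) (q zero)
  ⊛-cong p q (suc n) = +-cong (*-cong (p zero) (q (suc n))) (⊛-cong (p ∘ suc) q n)

  ⊛-distribʳ : ∀ h f g n → ((λ i → f i + g i) ⊛ h) n ≈ (f ⊛ h) n + (g ⊛ h) n
  ⊛-distribʳ h f g zero    = distribʳ _ _ _
  ⊛-distribʳ h f g (suc n) = begin
    (f 0 + g 0) * h (suc n) + ((λ i → f (suc i) + g (suc i)) ⊛ h) n
      ≈⟨ +-congˡ (⊛-distribʳ h (f ∘ suc) (g ∘ suc) n) ⟩
    (f 0 + g 0) * h (suc n) + (((f ∘ suc) ⊛ h) n + ((g ∘ suc) ⊛ h) n)
      ≈⟨ solve 5 (λ a b c x y → (a :+ b) :* c :+ (x :+ y) := (a :* c :+ x) :+ (b :* c :+ y)) refl _ _ _ _ _ ⟩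
    (f ⊛ h) (suc n) + (g ⊛ h) (suc n) ∎

  ⊛-scaleˡ : ∀ a f g n → ((λ i → a * f i) ⊛ g) n ≈ a * (f ⊛ g) n
  ⊛-scaleˡ a f g zero    = *-assoc _ _ _
  ⊛-scaleˡ a f g (suc n) = begin
    a * f 0 * g (suc n) + ((λ i → a * f (suc i)) ⊛ g) n ≈⟨ +-cong (*-assoc _ _ _) (⊛-scaleˡ a (f ∘ suc) g n) ⟩
    a * (f 0 * g (suc n)) + a * ((f ∘ suc) ⊛ g) n       ≈⟨ distribˡ _ _ _ ⟨
    a * (f ⊛ g) (suc n)                                 ∎

  ⊛-zeroˡ : ∀ g n → (0ˢ ⊛ g) n ≈ 0#
  ⊛-zeroˡ g zero    = zeroˡ _
  ⊛-zeroˡ g (suc n) = trans (+-cong (zeroˡ _) (⊛-zeroˡ g n)) (+-identityˡ 0#)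

  -- The mirror image of the defining recursion, unrolled along the right factor; comparing the two
  -- gives commutativity.
  ⊛-sucʳ : ∀ f g n → (f ⊛ g) (suc n) ≈ (f ⊛ (g ∘ suc)) n + f (suc n) * g 0
  ⊛-sucʳ f g zero    = refl
  ⊛-sucʳ f g (suc n) = trans (+-congˡ (⊛-sucʳ (f ∘ suc) g n)) (sym (+-assoc _ _ _))

  ⊛-comm : ∀ f g n → (f ⊛ g) n ≈ (g ⊛ f) n
  ⊛-comm f g zero    = *-comm _ _
  ⊛-comm f g (suc n) = begin
    f 0 * g (suc n) + ((f ∘ suc) ⊛ g) n ≈⟨ +-cong (*-comm _ _) (⊛-comm (f ∘ suc) g n) ⟩
    g (suc n) * f 0 + (g ⊛ (f ∘ suc)) n ≈⟨ +-comm _ _ ⟩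
    (g ⊛ (f ∘ suc)) n + g (suc n) * f 0 ≈⟨ ⊛-sucʳ g f n ⟨
    (g ⊛ f) (suc n)                     ∎

  ⊛-assoc : ∀ f g h n → ((f ⊛ g) ⊛ h) n ≈ (f ⊛ (g ⊛ h)) n
  ⊛-assoc f g h zero    = *-assoc _ _ _
  ⊛-assoc f g h (suc n) = begin
    f 0 * g 0 * h (suc n) + ((λ i → f 0 * g (suc i) + ((f ∘ suc) ⊛ g) i) ⊛ h) n
      ≈⟨ +-congˡ (⊛-distribʳ h _ _ n) ⟩
    f 0 * g 0 * h (suc n) + (((λ i → f 0 * g (suc i)) ⊛ h) n + (((f ∘ suc) ⊛ g) ⊛ h) n)
      ≈⟨ +-congˡ (+-cong (⊛-scaleˡ (f 0) (g ∘ suc) h n) (⊛-assoc (f ∘ suc) g h n)) ⟩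
    f 0 * g 0 * h (suc n) + (f 0 * ((g ∘ suc) ⊛ h) n + ((f ∘ suc) ⊛ (g ⊛ h)) n)
      ≈⟨ solve 5 (λ a b c x y → a :* b :* c :+ (a :* x :+ y) := a :* (b :* c :+ x) :+ y) refl _ _ _ _ _ ⟩
    (f ⊛ (g ⊛ h)) (suc n) ∎

  ⊛-identityˡ : ∀ f n → (1ˢ ⊛ f) n ≈ f n
  ⊛-identityˡ f zero    = *-identityˡ _
  ⊛-identityˡ f (suc n) = trans (+-cong (*-identityˡ _) (⊛-zeroˡ f n)) (+-identityʳ _)

  seriesRing : CommutativeRing c ℓ
  seriesRing = record
    { isCommutativeRing = record
      { isRing = record
        { +-isAbelianGroup = AbelianGroup.isAbelianGroup (Pointwise.abelianGroup ℕ +-abelianGroup)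
        ; *-cong     = ⊛-cong
        ; *-assoc    = ⊛-assoc
        ; *-identity = ⊛-identityˡ , λ f n → trans (⊛-comm f 1ˢ n) (⊛-identityˡ f n)
        ; distrib    = (λ f g h n → trans (⊛-comm f _ n)
                         (trans (⊛-distribʳ f g h n) (+-cong (⊛-comm g f n) (⊛-comm h f n))))
                     , ⊛-distribʳ
        }
      ; *-comm = ⊛-comm
      }
    }

-- Polynomials over a field with decidable equality

module Polynomials {c ℓ : Level} (K : DiscreteField c ℓ) where
  open DiscreteField K hiding (zero)
  open PowerSeries commutativeRing
  open FieldProperties field′ using (field-cancel)
  open RingProperties ring using (-0#≈0#)

  coeff : List Carrier → ℕ → Carrier
  coeff []      _       = 0#
  coeff (a ∷ p) zero    = a
  coeff (a ∷ p) (suc i) = coeff p i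

  -- Comparing coefficients identifies lists that differ by trailing zeros, so no normal form has to
  -- be maintained.
  _≈ᵖ_ : List Carrier → List Carrier → Set ℓ
  p ≈ᵖ q = ∀ i → coeff p i ≈ coeff q i

  _+ᵖ_ : List Carrier → List Carrier → List Carrier
  []      +ᵖ q       = q
  (a ∷ p) +ᵖ []      = a ∷ p
  (a ∷ p) +ᵖ (b ∷ q) = (a + b) ∷ (p +ᵖ q)

  _*ᵖ_ : List Carrier → List Carrier → List Carrier
  []      *ᵖ q = []
  (a ∷ p) *ᵖ q = map (a *_) q +ᵖ (0# ∷ (p *ᵖ q))

  coeff-+ : ∀ p q i → coeff (p +ᵖ q) i ≈ coeff p i + coeff q i
  coeff-+ []      q       i       = sym (+-identityˡ _)
  coeff-+ (a ∷ p) []      i       = sym (+-identityʳ _)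
  coeff-+ (a ∷ p) (b ∷ q) zero    = refl
  coeff-+ (a ∷ p) (b ∷ q) (suc i) = coeff-+ p q i

  coeff-scale : ∀ a p i → coeff (map (a *_) p) i ≈ a * coeff p i
  coeff-scale a []      i       = sym (zeroʳ a)
  coeff-scale a (b ∷ p) zero    = refl
  coeff-scale a (b ∷ p) (suc i) = coeff-scale a p i

  coeff-neg : ∀ p i → coeff (map (-_) p) i ≈ - coeff p i
  coeff-neg []      i       = sym -0#≈0#
  coeff-neg (b ∷ p) zero    = refl
  coeff-neg (b ∷ p) (suc i) = coeff-neg p i

  coeff-* : ∀ p q i → coeff (p *ᵖ q) i ≈ (coeff p ⊛ coeff q) i
  coeff-* []      q i       = sym (⊛-zeroˡ (coeff q) i)
  coeff-* (a ∷ p) q zero    =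
    trans (coeff-+ (map (a *_) q) _ 0) (trans (+-identityʳ _) (coeff-scale a q 0))
  coeff-* (a ∷ p) q (suc i) =
    trans (coeff-+ (map (a *_) q) _ (suc i)) (+-cong (coeff-scale a q (suc i)) (coeff-* p q i))

  coeff-1 : ∀ i → coeff (1# ∷ []) i ≈ 1ˢ i
  coeff-1 zero    = refl
  coeff-1 (suc i) = refl

  polyRawRing : RawRing c ℓ
  polyRawRing = record
    { Carrier = List Carrier ; _≈_ = _≈ᵖ_ ; _+_ = _+ᵖ_ ; _*_ = _*ᵖ_ ; -_ = map (-_) ; 0# = [] ; 1# = 1# ∷ [] }

  -- Equality of lists is equality of coefficients, so `coeff` is a monomorphism into power series
  -- and the ring laws are pulled back along it.
  polyRing : CommutativeRing c ℓ
  polyRing = record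
    { RawRing polyRawRing
    ; isCommutativeRing = RingMonomorphism.isCommutativeRing coeff-isRingMonomorphism
        (CommutativeRing.isCommutativeRing seriesRing) }
    where
    coeff-isRingMonomorphism : RingMorphisms.IsRingMonomorphism polyRawRing (CommutativeRing.rawRing seriesRing) coeff
    coeff-isRingMonomorphism = record
      { isRingHomomorphism = record
        { isSemiringHomomorphism = record
          { isNearSemiringHomomorphism = record
            { +-isMonoidHomomorphism = record
              { isMagmaHomomorphism = record
                { isRelHomomorphism = record { cong = λ p≈q → p≈q } ; homo = coeff-+ }
              ; ε-homo = λ _ → refl }
            ; *-homo = coeff-* }
          ; 1#-homo = coeff-1 }
        ; -‿homo = coeff-neg }
      ; injective = λ p≈q → p≈q }

  zero? : ∀ p → Dec (p ≈ᵖ [])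
  zero? []      = yes λ _ → refl
  zero? (a ∷ p) with a ≟ 0# | zero? p
  ... | yes a≈0 | yes p≈0 = yes λ { zero → a≈0 ; (suc i) → p≈0 i }
  ... | no  a≉0 | _       = no λ ap≈0 → a≉0 (ap≈0 0)
  ... | yes _   | no p≉0  = no λ ap≈0 → p≉0 (ap≈0 ∘ suc)

  module P = CommutativeRing polyRing

  _≟ᵖ_ : Decidable _≈ᵖ_
  p ≟ᵖ q = map′ (λ p-q≈0 → GroupProperties.x∙y⁻¹≈ε⇒x≈y P.+-group p q p-q≈0)
                (λ p≈q → GroupProperties.x≈y⇒x∙y⁻¹≈ε P.+-group {p} {q} p≈q)
                (zero? (p +ᵖ map (-_) q))

  -- Induction on both lists strips factors t until both constant terms are nonzero.
  poly-domain : ∀ p q → (p *ᵖ q) ≈ᵖ [] → (p ≈ᵖ []) ⊎ (q ≈ᵖ [])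
  poly-domain p q pq≈0 = go p q λ i → trans (sym (coeff-* p q i)) (pq≈0 i)
    where
    Conclusion : List Carrier → List Carrier → Set ℓ
    Conclusion p q = (∀ i → (coeff p ⊛ coeff q) i ≈ 0#) → (p ≈ᵖ []) ⊎ (q ≈ᵖ [])

    step : ∀ a p b q → Dec (a ≈ 0#) → Dec (b ≈ 0#) →
           Conclusion p (b ∷ q) → Conclusion (a ∷ p) q → Conclusion (a ∷ p) (b ∷ q)
    step a p b q (no a≉0)  (no b≉0)  _ _ pq≈0 = contradiction (field-cancel a≉0 (pq≈0 0)) b≉0
    step a p b q (yes a≈0) _         h _ pq≈0 = Sum.map₁ (λ { p≈0 zero → a≈0 ; p≈0 (suc i) → p≈0 i })
      (h λ i → trans (sym (trans (+-congʳ (trans (*-congʳ a≈0) (zeroˡ _))) (+-identityˡ _))) (pq≈0 (suc i)))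
    step a p b q (no _)    (yes b≈0) _ h pq≈0 = Sum.map₂ (λ { q≈0 zero → b≈0 ; q≈0 (suc i) → q≈0 i })
      (h λ i → trans (sym (trans (⊛-sucʳ (coeff (a ∷ p)) (coeff (b ∷ q)) i)
        (trans (+-congˡ (trans (*-congˡ b≈0) (zeroʳ _))) (+-identityʳ _)))) (pq≈0 (suc i)))

    go : ∀ p q → Conclusion p q
    go []      q       _ = inj₁ λ _ → refl
    go (a ∷ p) []      _ = inj₂ λ _ → refl
    go (a ∷ p) (b ∷ q)   = step a p b q (a ≟ 0#) (b ≟ 0#) (go p (b ∷ q)) (go (a ∷ p) q)

  poly-cancel : ∀ {p q} → ¬ (p ≈ᵖ []) → (p *ᵖ q) ≈ᵖ [] → q ≈ᵖ []
  poly-cancel {p} {q} p≉0 pq≈0 with poly-domain p q pq≈0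
  ... | inj₁ p≈0 = contradiction p≈0 p≉0
  ... | inj₂ q≈0 = q≈0

  open LinAlg commutativeRing using (∑)
  open LinAlg polyRing using () renaming (∑ to ∑ᵖ)
  open Sums commutativeRing using (∑-cong; ∑-δ; δ)

  coeff-∑ : ∀ {n} (f : Fin n → List Carrier) i → coeff (∑ᵖ f) i ≈ ∑ (λ j → coeff (f j) i)
  coeff-∑ {zero}  f i = refl
  coeff-∑ {suc n} f i = trans (coeff-+ (f zero) _ i) (+-congˡ (coeff-∑ (f ∘ suc) i))

  const : Carrier → List Carrier
  const a = a ∷ []

  const-* : ∀ a p i → coeff (const a *ᵖ p) i ≈ a * coeff p i
  const-* a p i = trans (coeff-+ (map (a *_) p) (0# ∷ []) i)
    (trans (+-cong (coeff-scale a p i) (z i)) (+-identityʳ _))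
    where
    z : ∀ i → coeff (0# ∷ []) i ≈ 0#
    z zero    = refl
    z (suc i) = refl

  monomial : ∀ {n} → Fin n → List Carrier
  monomial zero    = 1# ∷ []
  monomial (suc j) = 0# ∷ monomial j

  coeff-monomial : ∀ {n} (j i : Fin n) → coeff (monomial j) (toℕ i) ≡ δ j i
  coeff-monomial zero    zero    = ≡.refl
  coeff-monomial zero    (suc i) = ≡.refl
  coeff-monomial (suc j) zero    = ≡.refl
  coeff-monomial (suc j) (suc i) = coeff-monomial j i

  -- The coefficient of the sum in degree `toℕ i` is `a i`.
  monomials-indep : ∀ {n} (a : Fin n → Carrier) →
    ∑ᵖ (λ j → const (a j) *ᵖ monomial j) ≈ᵖ [] → ∀ i → a i ≈ 0#
  monomials-indep a ≈0 i = begin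
    a i                                                    ≈⟨ ∑-δ a i ⟨
    ∑ (λ j → a j * δ j i)                                  ≈⟨ ∑-cong (λ j → *-congˡ (reflexive (coeff-monomial j i))) ⟨
    ∑ (λ j → a j * coeff (monomial j) (toℕ i))             ≈⟨ ∑-cong (λ j → const-* (a j) (monomial j) (toℕ i)) ⟨
    ∑ (λ j → coeff (const (a j) *ᵖ monomial j) (toℕ i))    ≈⟨ coeff-∑ (λ j → const (a j) *ᵖ monomial j) (toℕ i) ⟨
    coeff (∑ᵖ (λ j → const (a j) *ᵖ monomial j)) (toℕ i)   ≈⟨ ≈0 (toℕ i) ⟩
    0#                                                     ∎
    where open SetoidReasoning setoid

  const-hom : RingHom commutativeRing polyRing const
  const-hom = mkRingHom commutativeRing polyRing const
    (λ { x≈y zero → x≈y ; x≈y (suc i) → refl })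
    (λ { x y zero → refl ; x y (suc i) → refl })
    (λ { x y zero → sym (+-identityʳ _) ; x y (suc i) → sym (trans (const-* x (const y) (suc i)) (zeroʳ x)) })
    (λ _ → refl)

-- The field of fractions of a domain

record IsDomain {c ℓ : Level} (R : CommutativeRing c ℓ) : Set (c ⊔ ℓ) where
  open CommutativeRing R
  field
    1≉0    : ¬ (1# ≈ 0#)
    cancel : ∀ {x y} → ¬ (x ≈ 0#) → x * y ≈ 0# → y ≈ 0#

module Fractions {c ℓ : Level} (R : CommutativeRing c ℓ)
  (_≟_ : Decidable (CommutativeRing._≈_ R)) (R-domain : IsDomain R) where

  open CommutativeRing R
  open IsDomain R-domain
  open SetoidReasoning setoid
  open SemiringSolver commutativeSemiring using (solve; _:=_; _:+_; _:*_)
  open RingProperties ring using (-‿distribˡ-*; -‿distribʳ-*)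

  -- Nonvanishing of the denominator is recorded as a Boolean so that fractions
  -- stay in the universe of the ring elements, whatever the level of _≈_.
  record Fraction : Set c where
    constructor _/_[_]
    field
      num den : Carrier
      den≉0   : False (den ≟ 0#)
  open Fraction

  den-nonzero : ∀ x → ¬ (den x ≈ 0#)
  den-nonzero x = toWitnessFalse (den≉0 x)

  *-nonzero : ∀ {x y} → ¬ (x ≈ 0#) → ¬ (y ≈ 0#) → ¬ (x * y ≈ 0#)
  *-nonzero x≉0 y≉0 xy≈0 = y≉0 (cancel x≉0 xy≈0)

  *-cancelˡ : ∀ {x y z} → ¬ (x ≈ 0#) → x * y ≈ x * z → y ≈ z
  *-cancelˡ {x} {y} {z} x≉0 xy≈xz = GroupProperties.x∙y⁻¹≈ε⇒x≈y +-group y z (cancel x≉0 (begin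
    x * (y + - z)     ≈⟨ distribˡ x y (- z) ⟩
    x * y + x * - z   ≈⟨ +-cong xy≈xz (sym (-‿distribʳ-* x z)) ⟩
    x * z + - (x * z) ≈⟨ -‿inverseʳ _ ⟩
    0#                ∎))

  infix 4 _≈ᶠ_
  _≈ᶠ_ : Fraction → Fraction → Set ℓ
  x ≈ᶠ y = num x * den y ≈ num y * den x

  _+ᶠ_ _*ᶠ_ : Fraction → Fraction → Fraction
  x +ᶠ y = (num x * den y + num y * den x) / den x * den y
           [ fromWitnessFalse (*-nonzero (den-nonzero x) (den-nonzero y)) ]
  x *ᶠ y = (num x * num y) / den x * den y
           [ fromWitnessFalse (*-nonzero (den-nonzero x) (den-nonzero y)) ]

  -ᶠ_ : Fraction → Fraction
  -ᶠ x = (- num x) / den x [ den≉0 x ]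

  fromRing : Carrier → Fraction
  fromRing a = a / 1# [ fromWitnessFalse 1≉0 ]

  -- Both sides agree after multiplication by the middle denominator `d`, which is nonzero and can
  -- be cancelled.
  ≈ᶠ-trans : ∀ {x y z} → x ≈ᶠ y → y ≈ᶠ z → x ≈ᶠ z
  ≈ᶠ-trans {a / b [ _ ]} {y@(c′ / d [ _ ])} {e / f [ _ ]} p q = *-cancelˡ (den-nonzero y) (begin
    d * (a * f)  ≈⟨ solve 3 (λ a d f → d :* (a :* f) := (a :* d) :* f) refl a d f ⟩
    a * d * f    ≈⟨ *-congʳ p ⟩
    c′ * b * f   ≈⟨ solve 3 (λ b c f → c :* b :* f := (c :* f) :* b) refl b c′ f ⟩
    c′ * f * b   ≈⟨ *-congʳ q ⟩
    e * d * b    ≈⟨ solve 3 (λ b d e → e :* d :* b := d :* (e :* b)) refl b d e ⟩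
    d * (e * b)  ∎)

  +ᶠ-cong : ∀ {x x′ y y′} → x ≈ᶠ x′ → y ≈ᶠ y′ → (x +ᶠ y) ≈ᶠ (x′ +ᶠ y′)
  +ᶠ-cong {a / b [ _ ]} {a′ / b′ [ _ ]} {d / e [ _ ]} {d′ / e′ [ _ ]} p q = begin
    (a * e + d * b) * (b′ * e′)
      ≈⟨ solve 6 (λ a b d e b′ e′ → (a :* e :+ d :* b) :* (b′ :* e′)
           := (a :* b′) :* (e :* e′) :+ (d :* e′) :* (b :* b′)) refl a b d e b′ e′ ⟩
    (a * b′) * (e * e′) + (d * e′) * (b * b′)
      ≈⟨ +-cong (*-congʳ p) (*-congʳ q) ⟩
    (a′ * b) * (e * e′) + (d′ * e) * (b * b′)
      ≈⟨ solve 6 (λ a′ b d′ e b′ e′ → (a′ :* b) :* (e :* e′) :+ (d′ :* e) :* (b :* b′)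
           := (a′ :* e′ :+ d′ :* b′) :* (b :* e)) refl a′ b d′ e b′ e′ ⟩
    (a′ * e′ + d′ * b′) * (b * e) ∎

  *ᶠ-cong : ∀ {x x′ y y′} → x ≈ᶠ x′ → y ≈ᶠ y′ → (x *ᶠ y) ≈ᶠ (x′ *ᶠ y′)
  *ᶠ-cong {a / b [ _ ]} {a′ / b′ [ _ ]} {d / e [ _ ]} {d′ / e′ [ _ ]} p q = begin
    (a * d) * (b′ * e′)
      ≈⟨ solve 4 (λ a d b′ e′ → (a :* d) :* (b′ :* e′) := (a :* b′) :* (d :* e′)) refl a d b′ e′ ⟩
    (a * b′) * (d * e′)
      ≈⟨ *-cong p q ⟩
    (a′ * b) * (d′ * e)
      ≈⟨ solve 4 (λ a d b′ e′ → (a :* b′) :* (d :* e′) := (a :* d) :* (b′ :* e′)) refl a′ d′ b e ⟩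
    (a′ * d′) * (b * e) ∎

  -ᶠ-cong : ∀ {x y} → x ≈ᶠ y → (-ᶠ x) ≈ᶠ (-ᶠ y)
  -ᶠ-cong {a / b [ _ ]} {d / e [ _ ]} p =
    trans (sym (-‿distribˡ-* a e)) (trans (-‿cong p) (-‿distribˡ-* d b))

  +ᶠ-inverseˡ : ∀ x → ((-ᶠ x) +ᶠ x) ≈ᶠ fromRing 0#
  +ᶠ-inverseˡ (a / b [ _ ]) = begin
    (- a * b + a * b) * 1# ≈⟨ *-identityʳ _ ⟩
    - a * b + a * b        ≈⟨ distribʳ b (- a) a ⟨
    (- a + a) * b          ≈⟨ *-congʳ (-‿inverseˡ a) ⟩
    0# * b                 ≈⟨ zeroˡ b ⟩
    0#                     ≈⟨ zeroˡ (b * b) ⟨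
    0# * (b * b)           ∎

  +ᶠ-comm : ∀ x y → (x +ᶠ y) ≈ᶠ (y +ᶠ x)
  +ᶠ-comm (a / b [ _ ]) (d / e [ _ ]) =
    solve 4 (λ a b d e → (a :* e :+ d :* b) :* (e :* b) := (d :* b :+ a :* e) :* (b :* e)) refl a b d e

  *ᶠ-comm : ∀ x y → (x *ᶠ y) ≈ᶠ (y *ᶠ x)
  *ᶠ-comm (a / b [ _ ]) (d / e [ _ ]) =
    solve 4 (λ a b d e → (a :* d) :* (e :* b) := (d :* a) :* (b :* e)) refl a b d e

  +ᶠ-identityˡ : ∀ x → (fromRing 0# +ᶠ x) ≈ᶠ x
  +ᶠ-identityˡ (a / b [ _ ]) = begin
    (0# * b + a * 1#) * b ≈⟨ *-congʳ (trans (+-cong (zeroˡ b) (*-identityʳ a)) (+-identityˡ a)) ⟩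
    a * b                 ≈⟨ *-congˡ (*-identityˡ b) ⟨
    a * (1# * b)          ∎

  *ᶠ-identityˡ : ∀ x → (fromRing 1# *ᶠ x) ≈ᶠ x
  *ᶠ-identityˡ (a / b [ _ ]) =
    trans (*-congʳ (*-identityˡ a)) (*-congˡ (sym (*-identityˡ b)))

  *ᶠ-distribˡ : ∀ x y z → (x *ᶠ (y +ᶠ z)) ≈ᶠ ((x *ᶠ y) +ᶠ (x *ᶠ z))
  *ᶠ-distribˡ (a / b [ _ ]) (d / e [ _ ]) (f / g [ _ ]) =
    solve 6 (λ a b d e f g → (a :* (d :* g :+ f :* e)) :* ((b :* e) :* (b :* g))
      := ((a :* d) :* (b :* g) :+ (a :* f) :* (b :* e)) :* (b :* (e :* g))) refl a b d e f g

  fractionRing : CommutativeRing c ℓ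
  fractionRing = record
    { Carrier = Fraction ; _≈_ = _≈ᶠ_ ; _+_ = _+ᶠ_ ; _*_ = _*ᶠ_ ; -_ = -ᶠ_
    ; 0# = fromRing 0# ; 1# = fromRing 1#
    ; isCommutativeRing = record
      { isRing = record
        { +-isAbelianGroup = record
          { isGroup = record
            { isMonoid = record
              { isSemigroup = record
                { isMagma = record
                  { isEquivalence = record
                    { refl = refl ; sym = sym
                    ; trans = λ {x} {y} {z} → ≈ᶠ-trans {x} {y} {z} }
                  ; ∙-cong = λ {x} {x′} {y} {y′} → +ᶠ-cong {x} {x′} {y} {y′} }
                ; assoc = λ { (a / b [ _ ]) (d / e [ _ ]) (f / g [ _ ]) →
                    solve 6 (λ a b d e f g →
                      ((a :* e :+ d :* b) :* g :+ f :* (b :* e)) :* (b :* (e :* g))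
                      := (a :* (e :* g) :+ (d :* g :+ f :* e) :* b) :* ((b :* e) :* g)) refl a b d e f g } }
              ; identity = +ᶠ-identityˡ , λ x →
                  ≈ᶠ-trans {x +ᶠ fromRing 0#} {fromRing 0# +ᶠ x} {x} (+ᶠ-comm x (fromRing 0#)) (+ᶠ-identityˡ x) }
            ; inverse = +ᶠ-inverseˡ , λ x →
                  ≈ᶠ-trans {x +ᶠ (-ᶠ x)} {(-ᶠ x) +ᶠ x} {fromRing 0#} (+ᶠ-comm x (-ᶠ x)) (+ᶠ-inverseˡ x)
            ; ⁻¹-cong = λ {x} {y} → -ᶠ-cong {x} {y} }
          ; comm = +ᶠ-comm }
        ; *-cong = λ {x} {x′} {y} {y′} → *ᶠ-cong {x} {x′} {y} {y′}
        ; *-assoc = λ { (a / b [ _ ]) (d / e [ _ ]) (f / g [ _ ]) →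
            solve 6 (λ a b d e f g → ((a :* d) :* f) :* (b :* (e :* g))
              := (a :* (d :* f)) :* ((b :* e) :* g)) refl a b d e f g }
        ; *-identity = *ᶠ-identityˡ , λ x →
            ≈ᶠ-trans {x *ᶠ fromRing 1#} {fromRing 1# *ᶠ x} {x} (*ᶠ-comm x (fromRing 1#)) (*ᶠ-identityˡ x)
        ; distrib = *ᶠ-distribˡ , λ x y z →
            ≈ᶠ-trans {(y +ᶠ z) *ᶠ x} {x *ᶠ (y +ᶠ z)} {(y *ᶠ x) +ᶠ (z *ᶠ x)} (*ᶠ-comm (y +ᶠ z) x)
              (≈ᶠ-trans {x *ᶠ (y +ᶠ z)} {(x *ᶠ y) +ᶠ (x *ᶠ z)} {(y *ᶠ x) +ᶠ (z *ᶠ x)} (*ᶠ-distribˡ x y z)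
                (+ᶠ-cong {x *ᶠ y} {y *ᶠ x} {x *ᶠ z} {z *ᶠ x} (*ᶠ-comm x y) (*ᶠ-comm x z))) }
      ; *-comm = *ᶠ-comm } }

  ≈ᶠ0⇒num≈0 : ∀ x → x ≈ᶠ fromRing 0# → num x ≈ 0#
  ≈ᶠ0⇒num≈0 x p = trans (sym (*-identityʳ _)) (trans p (zeroˡ _))

  fractionField : DiscreteField c ℓ
  fractionField = record
    { field′ = record
      { commutativeRing = fractionRing
      ; 1≉0     = 1≉0 ∘ ≈ᶠ0⇒num≈0 (fromRing 1#)
      ; inverse = λ { x@(a / b [ b≉0 ]) x≉0 →
          b / a [ fromWitnessFalse (λ a≈0 → x≉0 (trans (*-congʳ a≈0) (trans (zeroˡ 1#) (sym (zeroˡ b))))) ]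
          , solve 3 (λ a b u → (a :* b) :* u := u :* (b :* a)) refl a b 1# } }
    ; _≟_ = λ x y → (num x * den y) ≟ (num y * den x) }

  fromRing-hom : RingHom R fractionRing fromRing
  fromRing-hom = mkRingHom R fractionRing fromRing
    *-congʳ
    (λ x y → *-cong (sym (+-cong (*-identityʳ x) (*-identityʳ y))) (*-identityˡ 1#))
    (λ x y → *-congˡ (*-identityˡ 1#))
    refl

  fromRing-injective : ∀ {a} → fromRing a ≈ᶠ fromRing 0# → a ≈ 0#
  fromRing-injective {a} = ≈ᶠ0⇒num≈0 (fromRing a)

-- Extension of scalars along a ring homomorphism

module HomSums {c ℓ c′ ℓ′ : Level} (R : CommutativeRing c ℓ) (S : CommutativeRing c′ ℓ′)
  {f : CommutativeRing.Carrier R → CommutativeRing.Carrier S} (f-hom : RingHom R S f) where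
  open RingMorphisms.IsRingHomomorphism f-hom public
    using (+-homo; *-homo; 0#-homo; 1#-homo; -‿homo) renaming (⟦⟧-cong to hom-cong)
  private
    module R = CommutativeRing R
    module S = CommutativeRing S
    module LR = LinAlg R
    module LS = LinAlg S
  open Sums S using (∑-cong)

  hom-∑ : ∀ {m} (g : Fin m → R.Carrier) → f (LR.∑ g) S.≈ LS.∑ (f ∘ g)
  hom-∑ {zero}  g = 0#-homo
  hom-∑ {suc m} g = S.trans (+-homo _ _) (S.+-congˡ (hom-∑ (g ∘ suc)))

  hom-∑* : ∀ {m} (g h : Fin m → R.Carrier) →
           f (LR.∑ (λ i → g i R.* h i)) S.≈ LS.∑ (λ i → f (g i) S.* f (h i))
  hom-∑* g h = S.trans (hom-∑ (λ i → g i R.* h i)) (∑-cong λ i → *-homo (g i) (h i))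

  hom-lincomb : ∀ {m n} (a : Fin m → R.Carrier) (v : Fin m → LR.Vect n) →
    (f ∘ LR.lincomb a v) LS.≈ᵛ LS.lincomb (f ∘ a) (λ i → f ∘ v i)
  hom-lincomb a v j = hom-∑* a (λ i → v i j)

  hom-δ : ∀ {m} (i j : Fin m) → f (Sums.δ R i j) S.≈ Sums.δ S i j
  hom-δ zero    zero    = 1#-homo
  hom-δ zero    (suc j) = 0#-homo
  hom-δ (suc i) zero    = 0#-homo
  hom-δ (suc i) (suc j) = hom-δ i j

  hom-restrict : ∀ {n} (L : Subset n) (v : LR.Vect n) →
    (f ∘ Sums.restrict R L v) LS.≈ᵛ Sums.restrict S L (f ∘ v)
  hom-restrict L v j with j ∈? L
  ... | yes _ = 0#-homo
  ... | no  _ = S.refl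

-- One step of the tower of fields

-- The interface through which `K(t)` is used. The levels are unchanged because `Representable` asks
-- for a field at the levels of the ground field.
record Extension {c ℓ : Level} (K : DiscreteField c ℓ) (n : ℕ) : Set (lsuc (c ⊔ ℓ)) where
  private module K = DiscreteField K
  field
    K′     : DiscreteField c ℓ
  private module K′ = DiscreteField K′
  field
    embed     : K.Carrier → K′.Carrier
    embed-hom : RingHom K.commutativeRing K′.commutativeRing embed
    free      : Fin n → K′.Carrier
    free-indep : ∀ (a : Fin n → K.Carrier) → LinAlg.∑ K′.commutativeRing (λ j → embed (a j) K′.* free j) K′.≈ K′.0# →
                 ∀ (j : Fin n) → a j K.≈ K.0#

rationalFunctions : ∀ {c ℓ} (K : DiscreteField c ℓ) (n : ℕ) → Extension K n
rationalFunctions K n = record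
  { K′ = fractionField
  ; embed = fromRing ∘ const
  ; embed-hom = Composition.isRingHomomorphism
      (λ {x} {y} {z} → ≈ᶠ-trans {x} {y} {z}) const-hom fromRing-hom
  ; free = fromRing ∘ monomial
  -- All elements involved have denominator one, so the relation is one between polynomials, where
  -- coefficients can be compared.
  ; free-indep = λ a ≈0 → monomials-indep a (fromRing-injective {∑ᵖ λ j → const (a j) *ᵖ monomial j}
      (≈ᶠ-trans {fromRing (∑ᵖ λ j → const (a j) *ᵖ monomial j)}
                {∑ᶠ λ j → fromRing (const (a j)) *ᶠ fromRing (monomial j)} {fromRing []}
                (hom-∑* (const ∘ a) monomial) ≈0))
  }
  where
  open DiscreteField K using (1≉0)
  open Polynomials K
  polyRing-isDomain : IsDomain polyRing
  polyRing-isDomain = record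
    { 1≉0 = λ 1≈0 → 1≉0 (1≈0 0) ; cancel = λ {p} {q} → poly-cancel {p} {q} }
  open Fractions polyRing _≟ᵖ_ polyRing-isDomain
  open HomSums polyRing fractionRing fromRing-hom using (hom-∑*)
  open LinAlg polyRing using () renaming (∑ to ∑ᵖ)
  open LinAlg fractionRing using () renaming (∑ to ∑ᶠ)

-- Case distinctions on indices and zero tests

punchIn-view : ∀ {m} (i j : Fin (suc m)) → (j ≡ i) ⊎ (∃ λ l → j ≡ punchIn i l)
punchIn-view i j with i Fin.≟ j
... | yes i≡j = inj₁ (≡.sym i≡j)
... | no  i≢j = inj₂ (punchOut i≢j , ≡.sym (punchIn-punchOut i≢j))

module ZeroTests {c ℓ : Level} (K : DiscreteField c ℓ) where
  open DiscreteField K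

  allZero? : ∀ {m} (u : Fin m → Carrier) → (∀ i → u i ≈ 0#) ⊎ (∃ λ i → ¬ (u i ≈ 0#))
  allZero? {m} u with all? (λ i → u i ≟ 0#)
  ... | yes u≈0 = inj₁ u≈0
  ... | no  u≉0 = inj₂ (¬∀⟶∃¬ m _ (λ i → u i ≟ 0#) u≉0)

  allZero₂? : ∀ {m n} (u : Fin m → Fin n → Carrier) → (∀ i j → u i j ≈ 0#) ⊎ (∃₂ λ i j → ¬ (u i j ≈ 0#))
  allZero₂? {m} {n} u with all? (λ i → all? (λ j → u i j ≟ 0#))
  ... | yes u≈0 = inj₁ u≈0
  ... | no  u≉0 with ¬∀⟶∃¬ m _ (λ i → all? (λ j → u i j ≟ 0#)) u≉0
  ...   | i , ui≉0 = inj₂ (i , ¬∀⟶∃¬ n _ (λ j → u i j ≟ 0#) ui≉0)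

-- Gaussian elimination: kernels and extension of scalars

module Kernel {c ℓ : Level} (K : DiscreteField c ℓ) (K′ : Field c ℓ)
  {f : DiscreteField.Carrier K → Field.Carrier K′}
  (f-hom : RingHom (DiscreteField.commutativeRing K) (Field.commutativeRing K′) f) where

  private
    module K = DiscreteField K
    module K′ = Field K′
  open HomSums K.commutativeRing K′.commutativeRing f-hom
  open LinAlg K.commutativeRing
  open Sums K.commutativeRing
  open ZeroTests K
  private
    module L′ = LinAlg K′.commutativeRing
    module S′ = Sums K′.commutativeRing

  -- The basis is defined over K but has to span the relations with coefficients in K′.
  record KernelBasis {d k} (v : Fin d → Vect k) : Set (c ⊔ ℓ) where
    field
      nullity  : ℕ
      basis    : Fin nullity → Vect d
      indep    : LinIndep basis
      relation : ∀ i → lincomb (basis i) v ≈ᵛ 0ᵛ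
      spans    : ∀ x → L′.lincomb x (λ b → f ∘ v b) L′.≈ᵛ L′.0ᵛ →
                 L′.InSpan x (λ i → f ∘ basis i)
      rank≤    : d ≤ nullity ℕ.+ k

  -- One elimination step: `N` solves the system in the later coordinates, and multiples of `N p`
  -- clear the values `u` on coordinate zero. The scalar `μ` is `-1 / u p`, given by an equation
  -- without subtraction, so that the semiring solver can treat it and `f` can carry it to `K′`.
  module Pivot {d k} (v : Fin d → Vect (suc k)) {m} (N : Fin (suc m) → Vect d) (p : Fin (suc m))
    (μ : K.Carrier) (uμ+1≈0 : lincomb (N p) v zero K.* μ K.+ K.1# K.≈ K.0#) where

    u : Fin (suc m) → K.Carrier
    u c = lincomb (N c) v zero

    E : Fin m → Vect (suc m)
    E i = insertAt (δ i) p (u (punchIn p i) K.* μ)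

    N′ : Fin m → Vect d
    N′ i = lincomb (E i) N

    E-expand : ∀ {n} (w : Fin (suc m) → Vect n) i j →
      lincomb (E i) w j K.≈ u (punchIn p i) K.* μ K.* w p j K.+ w (punchIn p i) j
    E-expand w i j = K.trans (lincomb-insertAt (δ i) p _ w j) (K.+-congˡ (δ-∑ (w ∘ punchIn p) i j))

    N′-indep : LinIndep N → LinIndep N′
    N′-indep N-indep = lincomb-indep E N E-indep N-indep
      where
      E-indep : LinIndep E
      E-indep a aE≈0 l = begin
        a l                    ≈⟨ ∑-δ a l ⟨
        lincomb a δ l          ≈⟨ ∑-cong (λ i → K.*-congˡ (K.reflexive (insertAt-punchIn (δ i) p _ l))) ⟨
        lincomb a E (punchIn p l) ≈⟨ aE≈0 (punchIn p l) ⟩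
        K.0# ∎
        where open SetoidReasoning K.setoid

    N′-relation : (∀ c → lincomb (N c) (λ b → v b ∘ suc) ≈ᵛ 0ᵛ) → ∀ i → lincomb (N′ i) v ≈ᵛ 0ᵛ
    N′-relation rel i zero = begin
      lincomb (N′ i) v zero                             ≈⟨ lincomb-assoc (E i) N v zero ⟨
      lincomb (E i) (λ c → lincomb (N c) v) zero        ≈⟨ E-expand (λ c → lincomb (N c) v) i zero ⟩
      u (punchIn p i) K.* μ K.* u p K.+ u (punchIn p i) ≈⟨ solve 3 (λ x m y → x :* m :* y :+ x := x :* (y :* m :+ con 1)) K.refl (u (punchIn p i)) μ (u p) ⟩
      u (punchIn p i) K.* (u p K.* μ K.+ K.1#) ≈⟨ K.*-congˡ uμ+1≈0 ⟩
      u (punchIn p i) K.* K.0#                          ≈⟨ K.zeroʳ _ ⟩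
      K.0#                                              ∎
      where
      open SetoidReasoning K.setoid
      open SemiringSolver K.commutativeSemiring using (solve; _:=_; _:+_; _:*_; con)
    N′-relation rel i (suc j) = K.trans (K.sym (lincomb-assoc (E i) N v (suc j)))
      (∑-zero λ c → K.trans (K.*-congˡ {E i c} (rel c j)) (K.zeroʳ _))

    -- The condition on coordinate zero determines `y p` from the other coefficients, because the
    -- pivot is invertible already in `K`; substituting this value regroups `x` along `N′`.
    N′-spans : ∀ {x} y → x L′.≈ᵛ L′.lincomb y (λ c → f ∘ N c) →
      L′.∑ (λ c → y c K′.* f (u c)) K′.≈ K′.0# → x L′.≈ᵛ L′.lincomb (y ∘ punchIn p) (λ i → f ∘ N′ i)
    N′-spans {x} y x≈yN yu≈0 b = begin
      x b
        ≈⟨ x≈yN b ⟩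
      L′.lincomb y (λ c → f ∘ N c) b
        ≈⟨ S′.∑-remove p (λ c → y c K′.* f (N c b)) ⟩
      y p K′.* f (N p b) K′.+ L′.∑ (λ i → y′ i K′.* f (N (punchIn p i) b))
        ≈⟨ K′.+-congʳ (K′.*-congʳ yp≈) ⟩
      L′.∑ (λ i → y′ i K′.* fu i) K′.* f μ K′.* f (N p b) K′.+ L′.∑ (λ i → y′ i K′.* f (N (punchIn p i) b))
        ≈⟨ K′.+-congʳ (K′.trans (K′.*-assoc _ _ _) (S′.∑-* _ (λ i → y′ i K′.* fu i))) ⟩
      L′.∑ (λ i → y′ i K′.* fu i K′.* (f μ K′.* f (N p b))) K′.+ L′.∑ (λ i → y′ i K′.* f (N (punchIn p i) b))
        ≈⟨ S′.∑-+ (λ i → y′ i K′.* fu i K′.* (f μ K′.* f (N p b))) (λ i → y′ i K′.* f (N (punchIn p i) b)) ⟨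
      L′.∑ (λ i → y′ i K′.* fu i K′.* (f μ K′.* f (N p b)) K′.+ y′ i K′.* f (N (punchIn p i) b))
        ≈⟨ S′.∑-cong (λ i → solve 5 (λ y u m n n′ → y :* u :* (m :* n) :+ y :* n′ := y :* (u :* m :* n :+ n′)) K′.refl (y′ i) (fu i) (f μ) (f (N p b)) (f (N (punchIn p i) b))) ⟩
      L′.∑ (λ i → y′ i K′.* (fu i K′.* f μ K′.* f (N p b) K′.+ f (N (punchIn p i) b)))
        ≈⟨ S′.∑-cong (λ i → K′.*-congˡ (fN′≈ i)) ⟨
      L′.lincomb y′ (λ i → f ∘ N′ i) b ∎
      where
      open SetoidReasoning K′.setoid
      open SemiringSolver K′.commutativeSemiring using (solve; _:=_; _:+_; _:*_; con)
      y′ : Fin m → K′.Carrier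
      y′ = y ∘ punchIn p
      fu : Fin m → K′.Carrier
      fu i = f (u (punchIn p i))
      fN′≈ : ∀ i → f (N′ i b) K′.≈ fu i K′.* f μ K′.* f (N p b) K′.+ f (N (punchIn p i) b)
      fN′≈ i = K′.trans (hom-cong (E-expand N i b)) (K′.trans (+-homo _ _)
        (K′.+-congʳ (K′.trans (*-homo _ _) (K′.*-congʳ (*-homo _ _)))))
      S = L′.∑ (λ i → y′ i K′.* fu i)
      unit : f (u p) K′.* f μ K′.+ K′.1# K′.≈ K′.0#
      unit = K′.trans (K′.sym (K′.trans (+-homo _ _) (K′.+-cong (*-homo _ _) 1#-homo)))
        (K′.trans (hom-cong uμ+1≈0) 0#-homo)
      yp≈ : y p K′.≈ S K′.* f μ
      yp≈ = begin
        y p ≈⟨ K′.+-identityʳ _ ⟨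
        y p K′.+ K′.0# ≈⟨ K′.+-congˡ (K′.zeroˡ (f μ)) ⟨
        -- The zero is replaced by the relation `yu≈0` with its term at `p` split off; the factor
        -- `f (u p) * f μ + 1` then removes `y p`.
        y p K′.+ K′.0# K′.* f μ ≈⟨ K′.+-congˡ (K′.*-congʳ (K′.trans (K′.sym (S′.∑-remove p (λ c → y c K′.* f (u c)))) yu≈0)) ⟨
        y p K′.+ (y p K′.* f (u p) K′.+ S) K′.* f μ
          ≈⟨ solve 4 (λ y u s m → y :+ (y :* u :+ s) :* m := y :* (u :* m :+ con 1) :+ s :* m) K′.refl (y p) (f (u p)) S (f μ) ⟩
        y p K′.* (f (u p) K′.* f μ K′.+ K′.1#) K′.+ S K′.* f μ
          ≈⟨ K′.+-congʳ (K′.*-congˡ unit) ⟩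
        y p K′.* K′.0# K′.+ S K′.* f μ ≈⟨ K′.trans (K′.+-congʳ (K′.zeroʳ _)) (K′.+-identityˡ _) ⟩
        S K′.* f μ ∎

  negInverse : ∀ x → ¬ (x K.≈ K.0#) → ∃ λ μ → x K.* μ K.+ K.1# K.≈ K.0#
  negInverse x x≉0 = K.- proj₁ (K.inverse x x≉0) , (begin
    x K.* (K.- x⁻¹) K.+ K.1#     ≈⟨ K.+-cong (-‿distribʳ-* x x⁻¹) (proj₂ (K.inverse x x≉0)) ⟨
    K.- (x K.* x⁻¹) K.+ x K.* x⁻¹ ≈⟨ K.-‿inverseˡ _ ⟩
    K.0#                         ∎)
    where
    open SetoidReasoning K.setoid
    open RingProperties K.ring using (-‿distribʳ-*)
    x⁻¹ = proj₁ (K.inverse x x≉0)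

  -- Coordinates are imposed one at a time. A new one either vanishes on the basis so far or
  -- supplies a pivot and lowers the nullity by one. All pivots lie in `K`, so the same basis serves
  -- over `K′`.
  kernelBasis : ∀ {d k} (v : Fin d → Vect k) → KernelBasis v
  kernelBasis {d} {zero} v = record
    { nullity = d ; basis = δ ; relation = λ i ()
    ; indep = λ a aδ≈0 i → K.trans (K.sym (∑-δ a i)) (aδ≈0 i)
    ; spans = λ x _ → x , λ j → K′.trans (K′.sym (S′.∑-δ x j)) (S′.∑-cong λ i → K′.*-congˡ (K′.sym (hom-δ i j)))
    ; rank≤ = ℕₚ.≤-reflexive (≡.sym (ℕₚ.+-identityʳ d)) }
  kernelBasis {d} {suc k} v = extend nullity basis indep relation spans rank≤
    where
    open KernelBasis (kernelBasis (λ b → v b ∘ suc))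

    -- The nullity is a variable here so that matching can expose the successor forced by a pivot
    -- index `p`.
    extend : ∀ m (N : Fin m → Vect d) → LinIndep N →
      (∀ i → lincomb (N i) (λ b → v b ∘ suc) ≈ᵛ 0ᵛ) →
      (∀ x → L′.lincomb x (λ b → f ∘ v b ∘ suc) L′.≈ᵛ L′.0ᵛ → L′.InSpan x (λ i → f ∘ N i)) →
      d ≤ m ℕ.+ k → KernelBasis v
    extend m N N-indep rel spans d≤ with allZero? (λ c → lincomb (N c) v zero)
    ... | inj₁ u≈0 = record
      { nullity = m ; basis = N ; indep = N-indep
      ; relation = λ { i zero → u≈0 i ; i (suc j) → rel i j }
      ; spans = λ x xv≈0 → spans x (xv≈0 ∘ suc)
      ; rank≤ = ℕₚ.≤-trans d≤ (ℕₚ.+-monoʳ-≤ m (ℕₚ.n≤1+n k)) }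
    extend (suc m) N N-indep rel spans d≤ | inj₂ (p , up≉0) = record
      { nullity = m ; basis = N′ ; indep = N′-indep N-indep ; relation = N′-relation rel
      ; spans = λ x xv≈0 → let (y , x≈yN) = spans x (xv≈0 ∘ suc) in
          y ∘ punchIn p , N′-spans y x≈yN (K′.trans (yu≈ x y x≈yN) (xv≈0 zero))
      ; rank≤ = ℕₚ.≤-trans d≤ (ℕₚ.≤-reflexive (≡.sym (ℕₚ.+-suc m k))) }
      where
      open Pivot v N p (proj₁ (negInverse _ up≉0)) (proj₂ (negInverse _ up≉0))
      yu≈ : ∀ x y → x L′.≈ᵛ L′.lincomb y (λ c → f ∘ N c) →
        L′.∑ (λ c → y c K′.* f (lincomb (N c) v zero)) K′.≈ L′.lincomb x (λ b → f ∘ v b) zero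
      yu≈ x y x≈yN = begin
        L′.∑ (λ c → y c K′.* f (lincomb (N c) v zero))
          ≈⟨ S′.∑-cong (λ c → K′.*-congˡ {y c} (hom-lincomb (N c) v zero)) ⟩
        L′.lincomb y (λ c → L′.lincomb (f ∘ N c) (λ b → f ∘ v b)) zero
          ≈⟨ S′.lincomb-assoc y (λ c → f ∘ N c) (λ b → f ∘ v b) zero ⟩
        L′.lincomb (L′.lincomb y (λ c → f ∘ N c)) (λ b → f ∘ v b) zero
          ≈⟨ S′.lincomb-cong {v = λ b → f ∘ v b} x≈yN (λ _ _ → K′.refl) zero ⟨
        L′.lincomb x (λ b → f ∘ v b) zero ∎
        where open SetoidReasoning K′.setoid

-- Independence, extension to a basis, and transversals of nonzero entries

module Independence {c ℓ : Level} (K : DiscreteField c ℓ) where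
  open DiscreteField K hiding (zero)
  open LinAlg commutativeRing
  open Sums commutativeRing
  open ZeroTests K
  open FieldProperties field′
  open RingProperties ring using (-‿distribˡ-*; -0#≈0#)
  open SetoidReasoning setoid

  -- Dependence in positive form: the relation itself is the input for building a transversal and
  -- for the counting argument.
  Dependent : ∀ {d k} → (Fin d → Vect k) → Set (c ⊔ ℓ)
  Dependent {d} v = Σ (Fin d → Carrier) λ a → lincomb a v ≈ᵛ 0ᵛ × (∃ λ i → ¬ (a i ≈ 0#))

  dependent⇒¬indep : ∀ {d k} {v : Fin d → Vect k} → Dependent v → ¬ LinIndep v
  dependent⇒¬indep (a , av≈0 , i , ai≉0) v-indep = ai≉0 (v-indep a av≈0 i)

  indep⇒nonzero : ∀ {d k} {v : Fin d → Vect k} → LinIndep v → ∀ i → ¬ (v i ≈ᵛ 0ᵛ)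
  indep⇒nonzero {v = v} v-indep i vi≈0 =
    1≉0 (trans (sym (δ-diag i)) (v-indep (δ i) (λ j → trans (δ-∑ v i j) (vi≈0 j)) i))

  -- For the identity homomorphism, `spans` says that the kernel basis spans all relations over `K`
  -- itself.
  private
    open module Ker = Kernel K field′ (Identity.isRingHomomorphism rawRing refl) using (KernelBasis; kernelBasis)

  -- Nullity zero gives independence, and then `rank≤` is the dimension bound; otherwise the first
  -- kernel vector is a nontrivial relation.
  dependent-or-small : ∀ {d k} (v : Fin d → Vect k) → Dependent v ⊎ (LinIndep v × d ≤ k)
  dependent-or-small {d} {k} v = go nullity basis indep relation spans rank≤
    where
    open KernelBasis (kernelBasis v)
    go : ∀ m (N : Fin m → Vect d) → LinIndep N → (∀ i → lincomb (N i) v ≈ᵛ 0ᵛ) →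
      (∀ x → lincomb x v ≈ᵛ 0ᵛ → InSpan x N) → d ≤ m ℕ.+ k → Dependent v ⊎ (LinIndep v × d ≤ k)
    -- The empty combination reduces to `0#`, so lying in the span of an empty basis means
    -- vanishing.
    go zero    N _ _ spans d≤k = inj₂ ((λ a av≈0 → proj₂ (spans a av≈0)) , d≤k)
    go (suc m) N N-indep rel _ _ with allZero? (N zero)
    ... | inj₁ N≈0 = contradiction N≈0 (indep⇒nonzero {v = N} N-indep zero)
    ... | inj₂ N≉0 = inj₁ (N zero , rel zero , N≉0)

  indep? : ∀ {d k} (v : Fin d → Vect k) → Dependent v ⊎ LinIndep v
  indep? v with dependent-or-small v
  ... | inj₁ dep         = inj₁ dep
  ... | inj₂ (ind , _) = inj₂ ind

  indep⇒≤ : ∀ {d k} (v : Fin d → Vect k) → LinIndep v → d ≤ k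
  indep⇒≤ v v-indep with dependent-or-small v
  ... | inj₁ dep       = contradiction v-indep (dependent⇒¬indep dep)
  ... | inj₂ (_ , d≤k) = d≤k

  steinitz : ∀ {d r n} {v : Fin d → Vect n} {w : Fin r → Vect n} → LinIndep v → SubSpan v w → d ≤ r
  steinitz {w = w} v-indep v⊆w = indep⇒≤ (λ i → proj₁ (v⊆w i))
    (coordinates-indep (λ i → proj₁ (v⊆w i)) w (λ i → proj₂ (v⊆w i)) v-indep)

  -- Deleting a coordinate on which u does not vanish is injective on the hyperplane u · x = 0.
  hyperplane-bound : ∀ {m n} (y : Fin m → Vect n) → LinIndep y →
    (u : Vect n) → (∀ i → ∑ (λ e → y i e * u e) ≈ 0#) → ∀ p → ¬ (u p ≈ 0#) → suc m ≤ n
  hyperplane-bound {n = suc n} y y-indep u yu≈0 p up≉0 = s≤s (indep⇒≤ (λ i → y i ∘ punchIn p) λ a ay≈0 →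
    let x = lincomb a y
        xp≈0 : x p ≈ 0#
        xp≈0 = field-cancel up≉0 (begin
          u p * x p                                   ≈⟨ *-comm (u p) (x p) ⟩
          x p * u p                                   ≈⟨ +-identityʳ _ ⟨
          x p * u p + 0#                              ≈⟨ +-congˡ (∑-zero λ l → trans (*-congʳ (ay≈0 l)) (zeroˡ (u (punchIn p l)))) ⟨
          x p * u p + ∑ (λ l → x (punchIn p l) * u (punchIn p l)) ≈⟨ ∑-remove p (λ e → x e * u e) ⟨
          ∑ (λ e → x e * u e)                         ≈⟨ lincomb-assoc a y (λ e _ → u e) (Fin.zero {0}) ⟨
          ∑ (λ i → a i * ∑ (λ e → y i e * u e))       ≈⟨ ∑-zero (λ i → trans (*-congˡ {a i} (yu≈0 i)) (zeroʳ (a i))) ⟩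
          0#                                          ∎)
        x≈0 : ∀ j → x j ≈ 0#
        x≈0 j = case-view x xp≈0 ay≈0 j (punchIn-view p j)
    in y-indep a x≈0)
    where
    case-view : ∀ (x : Vect (suc n)) → x p ≈ 0# → (∀ l → x (punchIn p l) ≈ 0#) →
      ∀ j → (j ≡ p) ⊎ (∃ λ l → j ≡ punchIn p l) → x j ≈ 0#
    case-view x xp≈0 _   j (inj₁ ≡.refl)       = xp≈0
    case-view x _    x≈0 j (inj₂ (l , ≡.refl)) = x≈0 l

  -- What matters in a relation is the coefficient of `x`: if it vanishes, the relation is one among
  -- `E` alone, and otherwise it can be solved for `x`.
  cons-indep : ∀ {r n} (x : Vect n) (E : Fin r → Vect n) → LinIndep E → LinIndep (x ∷ᵛ E) ⊎ InSpan x E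
  cons-indep x E E-indep with indep? (x ∷ᵛ E)
  ... | inj₂ ind = inj₁ ind
  ... | inj₁ (a , aE≈0 , i , ai≉0) with a zero ≟ 0#
  ...   | yes a₀≈0 = contradiction a≈0 λ a≈0 → ai≉0 (a≈0 i)
    where
    a≈0 : ∀ i → a i ≈ 0#
    a≈0 zero    = a₀≈0
    a≈0 (suc i) = E-indep (a ∘ suc) (λ j → trans (sym (trans (+-congʳ (trans (*-congʳ a₀≈0) (zeroˡ _))) (+-identityˡ _))) (aE≈0 j)) i
  ...   | no a₀≉0 = inj₂ ((λ i → μ * a (suc i)) , λ j → begin
      x j                                            ≈⟨ +-identityʳ _ ⟨
      x j + 0#                                       ≈⟨ +-congˡ (trans (*-congˡ (aE≈0 j)) (zeroʳ μ)) ⟨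
      x j + μ * (a zero * x j + lincomb (a ∘ suc) E j)
        ≈⟨ solve 4 (λ x m a s → x :+ m :* (a :* x :+ s) := (a :* m :+ con 1) :* x :+ m :* s) refl (x j) μ (a zero) _ ⟩
      (a zero * μ + 1#) * x j + μ * lincomb (a ∘ suc) E j
        ≈⟨ trans (+-congʳ (trans (*-congʳ aμ+1≈0) (zeroˡ _))) (+-identityˡ _) ⟩
      μ * lincomb (a ∘ suc) E j                      ≈⟨ *-∑ μ (λ i → a (suc i) * E i j) ⟩
      ∑ (λ i → μ * (a (suc i) * E i j))              ≈⟨ ∑-cong (λ i → *-assoc μ (a (suc i)) (E i j)) ⟨
      lincomb (λ i → μ * a (suc i)) E j              ∎)
    where
    open SemiringSolver commutativeSemiring using (solve; _:=_; _:+_; _:*_; con)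
    μ = proj₁ (Ker.negInverse (a zero) a₀≉0)
    aμ+1≈0 = proj₂ (Ker.negInverse (a zero) a₀≉0)

  -- `position` locates `C` in the family, so that a matching of the family restricts to `C`.
  -- `source` bounds the span of the family and, for empty `C`, exhibits the family as a selection
  -- from `X`.
  record IndependentExtension {w p n} (C : Fin w → Vect n) (X : Fin p → Vect n) : Set (c ⊔ ℓ) where
    field
      size      : ℕ
      family    : Fin size → Vect n
      indep     : LinIndep family
      position  : Fin w → Fin size
      position-injective : Injective _≡_ _≡_ position
      extends   : ∀ i → family (position i) ≡ C i
      source    : ∀ i → (∃ λ j → family i ≡ C j) ⊎ (∃ λ t → family i ≡ X t)
      spans     : SubSpan X family

  extendIndependent : ∀ {w p n} (C : Fin w → Vect n) (X : Fin p → Vect n) → LinIndep C → IndependentExtension C X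
  extendIndependent {w} {zero} C X C-indep = record
    { size = w ; family = C ; indep = C-indep ; position = id ; position-injective = id
    ; extends = λ _ → ≡.refl ; source = λ i → inj₁ (i , ≡.refl) ; spans = λ () }
  extendIndependent {w} {suc p} C X C-indep = go (cons-indep (X zero) family indep)
    where
    open IndependentExtension (extendIndependent C (X ∘ suc) C-indep)
    lift-source : ∀ {v} → (∃ λ j → v ≡ C j) ⊎ (∃ λ t → v ≡ X (suc t)) → (∃ λ j → v ≡ C j) ⊎ (∃ λ t → v ≡ X t)
    lift-source (inj₁ s)       = inj₁ s
    lift-source (inj₂ (t , s)) = inj₂ (suc t , s)
    go : LinIndep (X zero ∷ᵛ family) ⊎ InSpan (X zero) family → IndependentExtension C X
    go (inj₁ ind) = record
      { size = suc size ; family = X zero ∷ᵛ family ; indep = ind ; position = suc ∘ position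
      ; position-injective = position-injective ∘ suc-injective ; extends = extends
      ; source = λ { zero → inj₂ (zero , ≡.refl) ; (suc i) → lift-source (source i) }
      ; spans = λ { zero → ∈-span (X zero ∷ᵛ family) zero
                  ; (suc t) → InSpan-trans {w = X zero ∷ᵛ family} (spans t) (λ i → ∈-span (X zero ∷ᵛ family) (suc i)) } }
    go (inj₂ x∈E) = record
      { size = size ; family = family ; indep = indep ; position = position
      ; position-injective = position-injective ; extends = extends
      ; source = λ i → lift-source (source i)
      ; spans = λ { zero → x∈E ; (suc t) → spans t } }

  -- This stands in for a nonzero term of a minor. If the vectors stay independent without
  -- coordinate zero, that coordinate is left unmatched. Otherwise a relation `a` in the later
  -- coordinates is nonzero in coordinate zero, so some `a b * v b zero` is nonzero; `b` takes
  -- coordinate zero, and the other vectors are independent in the later coordinates.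
  transversal : ∀ {k d} (v : Fin d → Vect k) → LinIndep v →
    Σ (Fin d → Fin k) λ π → Injective _≡_ _≡_ π × (∀ b → ¬ (v b (π b) ≈ 0#))
  -- Without coordinates every combination vanishes, so independence leaves no room for a vector.
  transversal {zero} v v-indep = (⊥-elim ∘ empty) , (λ {b} _ → ⊥-elim (empty b)) , (⊥-elim ∘ empty)
    where
    empty : ∀ b → _
    empty b = 1≉0 (v-indep (λ _ → 1#) (λ ()) b)
  transversal {suc k} {d} v v-indep with indep? (λ b → v b ∘ suc)
  ... | inj₂ ind =
    let (π , π-inj , π≉0) = transversal (λ b → v b ∘ suc) ind
    in suc ∘ π , π-inj ∘ suc-injective , π≉0
  ... | inj₁ (a , av≈0 , i , ai≉0) with allZero? (λ b → a b * v b zero)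
  ...   | inj₁ all≈0 = contradiction (v-indep a (λ { zero → ∑-zero all≈0 ; (suc j) → av≈0 j }) i) ai≉0
  transversal {suc k} {suc d} v v-indep | inj₁ (a , av≈0 , i , ai≉0) | inj₂ (b , avb≉0) =
    π , π-inj , π≉0
    where
    v′ : Fin d → Vect k
    v′ c = v (punchIn b c) ∘ suc

    -- With s, t the 0-th coordinates of a·v and y·v, the combination s y − t a is a relation
    -- among the v's; its b-th coefficient is − t a_b, so t = 0.
    v′-indep : LinIndep v′
    v′-indep x xv′≈0 l = trans (reflexive (≡.sym (insertAt-punchIn x b 0# l))) (y≈0 (punchIn b l))
      where
      y : Fin (suc d) → Carrier
      y = insertAt x b 0#
      yv≈0 : ∀ j → lincomb y v (suc j) ≈ 0#
      yv≈0 j = trans (lincomb-insertAt x b 0# v (suc j)) (trans (+-cong (zeroˡ _) (xv′≈0 j)) (+-identityˡ 0#))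
      s t : Carrier
      s = lincomb a v zero
      t = lincomb y v zero
      z≈0 : ∀ c → s * y c + - t * a c ≈ 0#
      z≈0 = v-indep _ λ
        { zero → begin
            lincomb (λ c → s * y c + - t * a c) v zero ≈⟨ lincomb-linear s (- t) y a v zero ⟩
            s * t + - t * s                            ≈⟨ +-cong (*-comm s t) (sym (-‿distribˡ-* t s)) ⟩
            t * s + - (t * s)                          ≈⟨ -‿inverseʳ _ ⟩
            0#                                         ∎
        ; (suc j) → begin
            lincomb (λ c → s * y c + - t * a c) v (suc j)           ≈⟨ lincomb-linear s (- t) y a v (suc j) ⟩
            s * lincomb y v (suc j) + - t * lincomb a v (suc j)     ≈⟨ +-cong (*-congˡ (yv≈0 j)) (*-congˡ (av≈0 j)) ⟩
            s * 0# + - t * 0#                                       ≈⟨ +-cong (zeroʳ s) (zeroʳ (- t)) ⟩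
            0# + 0#                                                 ≈⟨ +-identityˡ 0# ⟩
            0#                                                      ∎ }
      -t≈0 : - t ≈ 0#
      -t≈0 = field-cancel (λ ab≈0 → avb≉0 (trans (*-congʳ ab≈0) (zeroˡ _))) (begin
        a b * - t           ≈⟨ *-comm (a b) (- t) ⟩
        - t * a b           ≈⟨ +-identityˡ _ ⟨
        0# + - t * a b      ≈⟨ +-congʳ (trans (*-congˡ (reflexive (insertAt-lookup x b 0#))) (zeroʳ s)) ⟨
        s * y b + - t * a b ≈⟨ z≈0 b ⟩
        0#                  ∎)
      y≈0 : ∀ c → y c ≈ 0#
      y≈0 = v-indep y λ
        { zero → GroupProperties.⁻¹-injective +-group (trans -t≈0 (sym -0#≈0#))
        ; (suc j) → yv≈0 j }

    rec = transversal v′ v′-indep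
    π′ = proj₁ rec

    π : Fin (suc d) → Fin (suc k)
    π = insertAt (suc ∘ π′) b zero

    π-b : π b ≡ zero
    π-b = insertAt-lookup (suc ∘ π′) b zero
    π-rest : ∀ l → π (punchIn b l) ≡ suc (π′ l)
    π-rest = insertAt-punchIn (suc ∘ π′) b zero

    π≉0 : ∀ c → ¬ (v c (π c) ≈ 0#)
    π≉0 c with punchIn-view b c
    ... | inj₁ ≡.refl rewrite π-b = λ vb≈0 → avb≉0 (trans (*-congˡ vb≈0) (zeroʳ _))
    ... | inj₂ (l , ≡.refl) rewrite π-rest l = proj₂ (proj₂ rec) l

    π-inj : Injective _≡_ _≡_ π
    π-inj {c} {c′} eq with punchIn-view b c | punchIn-view b c′
    ... | inj₁ ≡.refl | inj₁ ≡.refl = ≡.refl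
    ... | inj₁ ≡.refl | inj₂ (l , ≡.refl) = contradiction (≡.trans (≡.sym π-b) (≡.trans eq (π-rest l))) λ ()
    ... | inj₂ (l , ≡.refl) | inj₁ ≡.refl = contradiction (≡.trans (≡.sym (π-rest l)) (≡.trans eq π-b)) λ ()
    ... | inj₂ (l , ≡.refl) | inj₂ (l′ , ≡.refl) = ≡.cong (punchIn b) (proj₁ (proj₂ rec)
            (suc-injective (≡.trans (≡.sym (π-rest l)) (≡.trans eq (π-rest l′)))))

-- The generic matrix, built row by row

module Genericity {c ℓ : Level} (F : DiscreteField c ℓ) (n : ℕ) where
  private
    module F = DiscreteField F
    module LF = LinAlg F.commutativeRing
    module SF = Sums F.commutativeRing

  -- A family of independent vectors of the span of B of size exceeding by m the number of
  -- coordinate subspaces ⟨ b_j : j ∈ L i ⟩ not containing it (these are listed by rows).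
  record Critical {k d} (L : Fin k → Subset n) (B : Fin d → LF.Vect n) (m : ℕ) : Set (c ⊔ ℓ) where
    field
      size      : ℕ
      coords    : Fin size → LF.Vect d
      indep     : LF.LinIndep coords
      count     : ℕ
      rows      : Fin count → Fin k
      bound     : count ℕ.+ m ≤ size
      contained : ∀ i → (∃ λ t → rows t ≡ i) ⊎ (∀ c j → j ∉ L i → LF.lincomb (coords c) B j F.≈ F.0#)

  -- `critical` is the induction hypothesis. It ranges over all `B` and `m`, since the step applies
  -- it with the nullity of the earlier rows in place of `m`, and to a family inside the new
  -- coordinate subspace in place of `B`.
  record Generic {k} (L : Fin k → Subset n) : Set (lsuc (c ⊔ ℓ)) where
    field
      K : DiscreteField c ℓ
    module K = DiscreteField K
    module LK = LinAlg K.commutativeRing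
    module SK = Sums K.commutativeRing
    field
      ι         : F.Carrier → K.Carrier
      ι-hom     : RingHom F.commutativeRing K.commutativeRing ι
      G         : Fin k → LK.Vect n
      G-support : ∀ i {j} → j ∈ L i → G i j K.≈ K.0#

    imageOf : LF.Vect n → LK.Vect k
    imageOf v = SK.image G (ι ∘ v)

    field
      critical  : ∀ {d} (B : Fin d → LF.Vect n) {m} (N : Fin m → LK.Vect d) → LK.LinIndep N →
                  (∀ c → LK.lincomb (N c) (imageOf ∘ B) LK.≈ᵛ LK.0ᵛ) → Critical L B m

  -- With no rows the kernel is everything and there is nothing to count, so `W` is all of `T`.
  noRows : (L : Fin 0 → Subset n) → Generic L
  noRows L = record
    { K = F ; ι = id ; ι-hom = Identity.isRingHomomorphism F.rawRing F.refl ; G = λ () ; G-support = λ ()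
    ; critical = λ {d} B N N-indep _ → record
      { size = d ; coords = SF.δ ; indep = λ a aδ≈0 i → F.trans (F.sym (SF.∑-δ a i)) (aδ≈0 i)
      ; count = 0 ; rows = λ () ; bound = Independence.indep⇒≤ F N N-indep ; contained = λ () } }

  module AddRow {k} (L : Fin (suc k) → Subset n) (gen : Generic (L ∘ suc))
    (ext : Extension (Generic.K gen) n) where
    open Generic gen
    open Extension ext
    open ZeroTests K
    private
      module K′ = DiscreteField K′
      module LK′ = LinAlg K′.commutativeRing
      module SK′ = Sums K′.commutativeRing
      module hι = HomSums F.commutativeRing K.commutativeRing ι-hom
      module hε = HomSums K.commutativeRing K′.commutativeRing embed-hom

    ι′ : F.Carrier → K′.Carrier
    ι′ = embed ∘ ι

    G′ : Fin (suc k) → LK′.Vect n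
    G′ = SK′.restrict (L zero) free ∷ᵛ λ i → embed ∘ G i

    G′-support : ∀ i {j} → j ∈ L i → G′ i j K′.≈ K′.0#
    G′-support zero    j∈L = K′.reflexive (SK′.restrict-∈ free j∈L)
    G′-support (suc i) j∈L = K′.trans (hε.hom-cong (G-support i j∈L)) hε.0#-homo

    -- The zeros of the row on `L zero` are moved onto the vector; this leaves a combination of
    -- `free` with coefficients from `K`, to which `free-indep` applies.
    newRow : ∀ z → SK′.image G′ (embed ∘ z) zero K′.≈
                   LK′.∑ (λ j → embed (SK.restrict (L zero) z j) K′.* free j)
    newRow z = SK′.∑-cong term
      where
      term : ∀ j → G′ zero j K′.* embed (z j) K′.≈ embed (SK.restrict (L zero) z j) K′.* free j
      term j with j ∈? L zero
      ... | yes _ = K′.trans (K′.zeroˡ _) (K′.sym (K′.trans (K′.*-congʳ hε.0#-homo) (K′.zeroˡ _)))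
      ... | no  _ = K′.*-comm _ _

    module _ {d} (B : Fin d → LF.Vect n) {m} (N′ : Fin m → LK′.Vect d) (N′-indep : LK′.LinIndep N′)
      (rel′ : ∀ c → LK′.lincomb (N′ c) (λ b → SK′.image G′ (ι′ ∘ B b)) LK′.≈ᵛ LK′.0ᵛ) where

      open Kernel K K′.field′ embed-hom using (module KernelBasis; kernelBasis)
      open KernelBasis (kernelBasis (imageOf ∘ B))
        renaming (basis to N; nullity to m₀; indep to N-indep; relation to N-relation; spans to N-spans)

      -- The earlier rows of `G′` have entries from `K`, so their kernel over `K′` is spanned by the
      -- basis `N` found over `K`.
      N′∈span : ∀ c → LK′.InSpan (N′ c) (λ e → embed ∘ N e)
      N′∈span c = N-spans (N′ c) λ i →
        K′.trans (SK′.∑-cong λ b → K′.*-congˡ (hε.hom-∑* (G i) (ι ∘ B b))) (rel′ c (suc i))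

      y : Fin m → LK′.Vect m₀
      y c = proj₁ (N′∈span c)

      y-indep : LK′.LinIndep y
      y-indep = SK′.coordinates-indep y (λ e → embed ∘ N e) (λ c → proj₂ (N′∈span c)) N′-indep

      Z : Fin m₀ → LK.Vect n
      Z e = LK.lincomb (N e) (λ b → ι ∘ B b)

      u : LK′.Vect m₀
      u e = SK′.image G′ (embed ∘ Z e) zero

      yZ≈N′B : ∀ c → LK′.lincomb (y c) (λ e → embed ∘ Z e) LK′.≈ᵛ LK′.lincomb (N′ c) (λ b → ι′ ∘ B b)
      yZ≈N′B c j = begin
        LK′.lincomb (y c) (λ e → embed ∘ Z e) j
          ≈⟨ SK′.∑-cong (λ e → K′.*-congˡ (hε.hom-lincomb (N e) (λ b → ι ∘ B b) j)) ⟩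
        LK′.lincomb (y c) (λ e → LK′.lincomb (embed ∘ N e) (λ b → ι′ ∘ B b)) j
          ≈⟨ SK′.lincomb-assoc (y c) (λ e → embed ∘ N e) (λ b → ι′ ∘ B b) j ⟩
        LK′.lincomb (LK′.lincomb (y c) (λ e → embed ∘ N e)) (λ b → ι′ ∘ B b) j
          ≈⟨ SK′.∑-cong (λ b → K′.*-congʳ (proj₂ (N′∈span c) b)) ⟨
        LK′.lincomb (N′ c) (λ b → ι′ ∘ B b) j ∎
        where open SetoidReasoning K′.setoid

      yu≈0 : ∀ c → LK′.∑ (λ e → y c e K′.* u e) K′.≈ K′.0#
      yu≈0 c = begin
        LK′.lincomb (y c) (λ e → SK′.image G′ (embed ∘ Z e)) zero
          ≈⟨ SK′.image-lincomb G′ (y c) (λ e → embed ∘ Z e) zero ⟨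
        SK′.image G′ (LK′.lincomb (y c) (λ e → embed ∘ Z e)) zero
          ≈⟨ SK′.image-cong G′ (yZ≈N′B c) zero ⟩
        SK′.image G′ (LK′.lincomb (N′ c) (λ b → ι′ ∘ B b)) zero
          ≈⟨ SK′.image-lincomb G′ (N′ c) (λ b → ι′ ∘ B b) zero ⟩
        LK′.lincomb (N′ c) (λ b → SK′.image G′ (ι′ ∘ B b)) zero
          ≈⟨ rel′ c zero ⟩
        K′.0# ∎
        where open SetoidReasoning K′.setoid

      -- By `free-indep` the functional `u` is nonzero at `e`, and the vectors `y` lie in its
      -- hyperplane, so `suc m ≤ m₀`. This gain of one pays for listing row zero, which is done
      -- without asking whether `W` lies in its coordinate subspace.
      newRow-cuts : ∀ e j → ¬ (SK.restrict (L zero) (Z e) j K.≈ K.0#) → Critical L B m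
      newRow-cuts e j Z≉0 = record
        { size = size ; coords = coords ; indep = indep
        ; count = suc count ; rows = zero ∷ᵛ (suc ∘ rows)
        ; bound = ℕₚ.≤-trans (ℕₚ.≤-reflexive (≡.sym (ℕₚ.+-suc count m))) (ℕₚ.≤-trans (ℕₚ.+-monoʳ-≤ count m<m₀) bound)
        ; contained = λ { zero → inj₁ (zero , ≡.refl)
                        ; (suc i) → Sum.map₁ (λ { (t , eq) → suc t , ≡.cong suc eq }) (contained i) } }
        where
        open Critical (critical B N N-indep N-relation)
        ue≉0 : ¬ (u e K′.≈ K′.0#)
        ue≉0 ue≈0 = Z≉0 (free-indep (SK.restrict (L zero) (Z e)) (K′.trans (K′.sym (newRow (Z e))) ue≈0) j)
        m<m₀ : suc m ≤ m₀
        m<m₀ = Independence.hyperplane-bound K′ y y-indep u yu≈0 e ue≉0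

      -- The kernel lies in X₀ ⊗ K, so it is the kernel on the intersection of the span of B
      -- with X₀, which is the span of B₁.
      newRow-vanishes : (∀ e j → SK.restrict (L zero) (Z e) j K.≈ K.0#) → Critical L B m
      newRow-vanishes Z≈0 = record
        { size = size ; coords = λ c → LF.lincomb (coords c) D ; indep = SF.lincomb-indep coords D indep D-indep
        ; count = count ; rows = suc ∘ rows
        ; bound = ℕₚ.≤-trans (ℕₚ.+-monoʳ-≤ count (Independence.indep⇒≤ K′ y y-indep)) bound
        ; contained = λ { zero → inj₂ λ c j j∉L → F.trans (F.sym (SF.lincomb-assoc (coords c) D B j))
                            (SF.∑-zero λ e → F.trans (F.*-congˡ {coords c e} (B₁-off e j∉L)) (F.zeroʳ _))
                        ; (suc i) → Sum.map (λ { (t , eq) → t , ≡.cong suc eq })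
                            (λ h c j j∉L → F.trans (F.sym (SF.lincomb-assoc (coords c) D B j)) (h c j j∉L))
                            (contained i) } }
        where
        B₀ : Fin d → LF.Vect n
        B₀ b = SF.restrict (L zero) (B b)
        module KF = Kernel F K.field′ ι-hom
        open KF.KernelBasis (KF.kernelBasis B₀)
          renaming (basis to D; nullity to m₁; indep to D-indep; relation to D-relation; spans to D-spans)
        B₁ : Fin m₁ → LF.Vect n
        B₁ e = LF.lincomb (D e) B
        B₁-off : ∀ e {j} → j ∉ L zero → B₁ e j F.≈ F.0#
        B₁-off e {j} j∉L = F.trans (F.reflexive (≡.sym (SF.restrict-∉ (B₁ e) j∉L)))
          (F.trans (F.sym (SF.lincomb-restrict (L zero) (D e) B j)) (D-relation e j))
        -- A combination of `B` lies in the coordinate subspace exactly when its coefficients form a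
        -- relation of `B₀`. That system is defined over the ground field, so its solutions there
        -- span those over `K`.
        N∈span : ∀ e → LK.InSpan (N e) (λ i → ι ∘ D i)
        N∈span e = D-spans (N e) λ j → begin
          LK.lincomb (N e) (λ b → ι ∘ B₀ b) j
            ≈⟨ SK.∑-cong (λ b → K.*-congˡ (hι.hom-restrict (L zero) (B b) j)) ⟩
          LK.lincomb (N e) (λ b → SK.restrict (L zero) (ι ∘ B b)) j
            ≈⟨ SK.lincomb-restrict (L zero) (N e) (λ b → ι ∘ B b) j ⟩
          SK.restrict (L zero) (Z e) j
            ≈⟨ Z≈0 e j ⟩
          K.0# ∎
          where open SetoidReasoning K.setoid
        z : Fin m₀ → LK.Vect m₁
        z e = proj₁ (N∈span e)
        z-relation : ∀ e → LK.lincomb (z e) (imageOf ∘ B₁) LK.≈ᵛ LK.0ᵛ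
        z-relation e i = begin
          LK.lincomb (z e) (imageOf ∘ B₁) i
            ≈⟨ SK.image-lincomb G (z e) (λ l → ι ∘ B₁ l) i ⟨
          SK.image G (LK.lincomb (z e) (λ l → ι ∘ B₁ l)) i
            ≈⟨ SK.image-cong G (λ j → SK.∑-cong λ l → K.*-congˡ (hι.hom-lincomb (D l) B j)) i ⟩
          SK.image G (LK.lincomb (z e) (λ l → LK.lincomb (ι ∘ D l) (λ b → ι ∘ B b))) i
            ≈⟨ SK.image-cong G (SK.lincomb-assoc (z e) (λ l → ι ∘ D l) (λ b → ι ∘ B b)) i ⟩
          SK.image G (LK.lincomb (LK.lincomb (z e) (λ l → ι ∘ D l)) (λ b → ι ∘ B b)) i
            ≈⟨ SK.image-cong G (λ j → SK.∑-cong λ b → K.*-congʳ (proj₂ (N∈span e) b)) i ⟨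
          SK.image G (LK.lincomb (N e) (λ b → ι ∘ B b)) i
            ≈⟨ SK.image-lincomb G (N e) (λ b → ι ∘ B b) i ⟩
          LK.lincomb (N e) (imageOf ∘ B) i
            ≈⟨ N-relation e i ⟩
          K.0# ∎
          where open SetoidReasoning K.setoid
        open Critical (critical B₁ z
          (SK.coordinates-indep z (λ i → ι ∘ D i) (λ e → proj₂ (N∈span e)) N-indep) z-relation)

      critical′ : Critical L B m
      critical′ with allZero₂? (λ e → SK.restrict (L zero) (Z e))
      ... | inj₁ Z≈0           = newRow-vanishes Z≈0
      ... | inj₂ (e , j , Z≉0) = newRow-cuts e j Z≉0

    addRow : Generic L
    addRow = record
      { K = K′ ; ι = ι′ ; ι-hom = Composition.isRingHomomorphism K′.trans ι-hom embed-hom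
      ; G = G′ ; G-support = G′-support ; critical = critical′ }

  generic : ∀ {k} (L : Fin k → Subset n) → Generic L
  generic {zero}  L = noRows L
  generic {suc k} L = AddRow.addRow L (generic (L ∘ suc)) (rationalFunctions _ n)

-- The generic matrix represents the transversal matroid

discrete : ∀ {c ℓ} → FiniteField c ℓ → DiscreteField c ℓ
discrete F = record { field′ = FiniteField.field′ F ; _≟_ = FiniteField._≟_ F }

module Representation {c ℓ : Level} (F : FiniteField c ℓ) {n k : ℕ} (L : Fin k → Subset n)
  (gen : Genericity.Generic (discrete F) n L) where
  private
    F′ : DiscreteField c ℓ
    F′ = discrete F
  open Genericity F′ n
  open Generic gen
  open QTransversal F
  private
    module F = DiscreteField F′
    module LF = LinAlg F.commutativeRing
    module SF = Sums F.commutativeRing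
    module hι = HomSums F.commutativeRing K.commutativeRing ι-hom
    module IF = Independence F′
    module IK = Independence K

  ι-zero : ∀ {x} → ι x K.≈ K.0# → x F.≈ F.0#
  ι-zero {x} ιx≈0 with x F.≟ F.0#
  ... | yes x≈0 = x≈0
  ... | no  x≉0 = contradiction (begin
      K.1#                                      ≈⟨ hι.1#-homo ⟨
      ι F.1#                                    ≈⟨ hι.hom-cong (proj₂ (F.inverse x x≉0)) ⟨
      ι (x F.* proj₁ (F.inverse x x≉0))         ≈⟨ hι.*-homo _ _ ⟩
      ι x K.* ι (proj₁ (F.inverse x x≉0))       ≈⟨ K.*-congʳ ιx≈0 ⟩
      K.0# K.* ι (proj₁ (F.inverse x x≉0))      ≈⟨ K.zeroˡ _ ⟩
      K.0#                                      ∎) K.1≉0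
    where open SetoidReasoning K.setoid

  ι-injective : Injective F._≈_ K._≈_ ι
  ι-injective {x} {y} ιx≈ιy = GroupProperties.x∙y⁻¹≈ε⇒x≈y F.+-group x y (ι-zero (begin
    ι (x F.+ F.- y)     ≈⟨ hι.+-homo _ _ ⟩
    ι x K.+ ι (F.- y)   ≈⟨ K.+-cong ιx≈ιy (hι.-‿homo y) ⟩
    ι y K.+ K.- ι y     ≈⟨ K.-‿inverseʳ _ ⟩
    K.0#                ∎))
    where open SetoidReasoning K.setoid

  lincomb-e : ∀ (a : LF.Vect n) → LF.lincomb a e LF.≈ᵛ a
  lincomb-e a j = F.trans (SF.∑-cong λ i → F.*-congˡ (e≈δ i j)) (SF.∑-δ a j)
    where
    e≈δ : ∀ (i j : Fin n) → e i j F.≈ SF.δ i j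
    e≈δ i j with i Fin.≟ j
    ... | yes ≡.refl = F.sym (SF.δ-diag i)
    ... | no  i≢j    = F.sym (SF.δ-off i≢j)

  vanishes⇒InCoordSpan : ∀ {S v} → (∀ j → j ∉ S → v j F.≈ F.0#) → InCoordSpan S v
  vanishes⇒InCoordSpan {v = v} v≈0 = v , v≈0 , λ j → F.sym (lincomb-e v j)

  InCoordSpan⇒vanishes : ∀ {S v} → InCoordSpan S v → ∀ {j} → j ∉ S → v j F.≈ F.0#
  InCoordSpan⇒vanishes (a , a≈0 , v≈a) {j} j∉S = F.trans (v≈a j) (F.trans (lincomb-e a j) (a≈0 j j∉S))

  imageOf-zero : ∀ i {v} → InCoordSpan (L i) v → imageOf v i K.≈ K.0#
  imageOf-zero i {v} v∈X = SK.∑-zero term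
    where
    term : ∀ j → G i j K.* ι (v j) K.≈ K.0#
    term j with j ∈? L i
    ... | yes j∈L = K.trans (K.*-congʳ (G-support i j∈L)) (K.zeroˡ _)
    ... | no  j∉L = K.trans (K.*-congˡ (K.trans (hι.hom-cong (InCoordSpan⇒vanishes v∈X j∉L)) hι.0#-homo)) (K.zeroʳ _)

  imageOf-lincomb : ∀ {m} (a : Fin m → F.Carrier) (v : Fin m → LF.Vect n) {w} → w LF.≈ᵛ LF.lincomb a v →
    imageOf w LK.≈ᵛ LK.lincomb (ι ∘ a) (imageOf ∘ v)
  imageOf-lincomb a v {w} w≈av i = begin
    SK.image G (ι ∘ w) i                                ≈⟨ SK.image-cong G (λ j → K.trans (hι.hom-cong (w≈av j)) (hι.hom-lincomb a v j)) i ⟩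
    SK.image G (LK.lincomb (ι ∘ a) (λ l → ι ∘ v l)) i   ≈⟨ SK.image-lincomb G (ι ∘ a) (λ l → ι ∘ v l) i ⟩
    LK.lincomb (ι ∘ a) (imageOf ∘ v) i                  ∎
    where open SetoidReasoning K.setoid

  imageOf-InSpan : ∀ {m} {v : Fin m → LF.Vect n} {w} → LF.InSpan w v → LK.InSpan (imageOf w) (imageOf ∘ v)
  imageOf-InSpan {v = v} (a , w≈av) = ι ∘ a , imageOf-lincomb a v w≈av

  indep-descends : ∀ {m} {v : Fin m → LF.Vect n} → LK.LinIndep (imageOf ∘ v) → LF.LinIndep v
  indep-descends {v = v} g-indep a av≈0 i = ι-zero (g-indep (ι ∘ a) (λ l → K.trans
    (K.sym (imageOf-lincomb a v (λ j → F.sym (av≈0 j)) l))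
    (SK.∑-zero λ j → K.trans (K.*-congˡ hι.0#-homo) (K.zeroʳ (G l j)))) i)

  -- With `A` and `D` the coordinates of `B` in `Y` and of `Y` in `B`, independence of `B` gives
  -- `A D = 1`. A relation `x` among the images of `B` yields the relation `x A` among those of `Y`,
  -- so `x = x A D = 0`.
  basis-image-indep : ∀ {r d} {Y : Fin r → LF.Vect n} {B : Fin d → LF.Vect n} →
    LK.LinIndep (imageOf ∘ Y) → LF.IsBasisOf B Y → LK.LinIndep (imageOf ∘ B)
  basis-image-indep {Y = Y} {B} gY-indep (B-indep , B⊆Y , Y⊆B) x xgB≈0 b = begin
    x b                                                        ≈⟨ SK.∑-δ x b ⟨
    LK.lincomb x SK.δ b                                        ≈⟨ SK.∑-cong (λ i → K.*-congˡ (AD≈δ i b)) ⟨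
    LK.lincomb x (λ i → LK.lincomb (ι ∘ A i) (λ t → ι ∘ D t)) b ≈⟨ SK.lincomb-assoc x (λ i → ι ∘ A i) (λ t → ι ∘ D t) b ⟩
    LK.lincomb (LK.lincomb x (λ i → ι ∘ A i)) (λ t → ι ∘ D t) b ≈⟨ SK.lincomb-zero {v = λ t → ι ∘ D t} xA≈0 b ⟩
    K.0#                                                       ∎
    where
    open SetoidReasoning K.setoid
    A = λ i → proj₁ (B⊆Y i)
    D = λ t → proj₁ (Y⊆B t)
    xA≈0 : LK.lincomb x (λ i → ι ∘ A i) LK.≈ᵛ LK.0ᵛ
    xA≈0 = gY-indep _ λ l → begin
      LK.lincomb (LK.lincomb x (λ i → ι ∘ A i)) (imageOf ∘ Y) l
        ≈⟨ SK.lincomb-assoc x (λ i → ι ∘ A i) (imageOf ∘ Y) l ⟨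
      LK.lincomb x (λ i → LK.lincomb (ι ∘ A i) (imageOf ∘ Y)) l
        ≈⟨ SK.∑-cong (λ i → K.*-congˡ (imageOf-lincomb (A i) Y (proj₂ (B⊆Y i)) l)) ⟨
      LK.lincomb x (imageOf ∘ B) l
        ≈⟨ xgB≈0 l ⟩
      K.0# ∎
    AD≈δ : ∀ i → LK.lincomb (ι ∘ A i) (λ t → ι ∘ D t) LK.≈ᵛ SK.δ i
    AD≈δ i j = K.trans (K.sym (hι.hom-lincomb (A i) D j)) (K.trans (hι.hom-cong
      (SF.coordinates-unique B-indep {LF.lincomb (A i) D} {SF.δ i} (λ l →
        F.trans (F.sym (SF.lincomb-assoc (A i) D B l))
          (F.trans (F.sym (F.trans (proj₂ (B⊆Y i) l) (SF.∑-cong λ t → F.*-congˡ (proj₂ (Y⊆B t) l))))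
            (F.sym (SF.δ-∑ B i l)))) j)) (hι.hom-δ i j))

  indep⇒partialTransversal : ∀ {r} {Y : Fin r → LF.Vect n} →
    LK.LinIndep (imageOf ∘ Y) → PartialTransversal L Y
  indep⇒partialTransversal gY-indep d B B-basis =
    avoid (IK.transversal (imageOf ∘ B) (basis-image-indep gY-indep B-basis))
    where
    avoid : (Σ (Fin d → Fin k) λ π → Injective _≡_ _≡_ π × (∀ b → ¬ (imageOf (B b) (π b) K.≈ K.0#))) →
      Σ (Fin d → Fin k) λ π → Injective _≡_ _≡_ π × (∀ b → ¬ InCoordSpan (L (π b)) (B b))
    avoid (π , π-injective , π≉0) = π , π-injective , λ b Bb∈X → π≉0 b (imageOf-zero (π b) Bb∈X)

  module _ {d} {B : Fin d → LF.Vect n} (crit : Critical L B 1) where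
    open Critical crit

    private
      C : Fin size → LF.Vect n
      C c = LF.lincomb (coords c) B

    -- Pigeonhole: a basis vector coming from `W` can only be matched to a coordinate subspace that
    -- does not contain `W`, hence to a listed row, and there are fewer of these than the dimension
    -- of `W`.
    extension-not-matchable : (E : IF.IndependentExtension C B) (let open IF.IndependentExtension E renaming (size to d′)) →
      (π : Fin d′ → Fin k) → Injective _≡_ _≡_ π → ¬ (∀ b → ¬ InCoordSpan (L (π b)) (family b))
    extension-not-matchable E π π-injective π∉ = ℕₚ.<⇒≱ count<size (injective⇒≤ τ-injective)
      where
      open IF.IndependentExtension E
      row : ∀ c → ∃ λ t → rows t ≡ π (position c)
      row c with contained (π (position c))
      ... | inj₁ hit  = hit
      ... | inj₂ miss = ⊥-elim (π∉ (position c) (vanishes⇒InCoordSpan λ j j∉L →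
              F.trans (F.reflexive (≡.cong (λ v → v j) (extends c))) (miss c j j∉L)))
      τ : Fin (Critical.size crit) → Fin count
      τ c = proj₁ (row c)
      τ-injective : Injective _≡_ _≡_ τ
      τ-injective {c} {c′} eq = position-injective (π-injective
        (≡.trans (≡.sym (proj₂ (row c))) (≡.trans (≡.cong rows eq) (proj₂ (row c′)))))
      count<size : suc count ≤ Critical.size crit
      count<size = ℕₚ.≤-trans (ℕₚ.≤-reflexive (ℕₚ.+-comm 1 count)) bound

    extension-basis : ∀ {s} {Y : Fin s → LF.Vect n} → LF.IsBasisOf B Y →
      (E : IF.IndependentExtension C B) → LF.IsBasisOf (IF.IndependentExtension.family E) Y
    extension-basis {Y = Y} (_ , B⊆Y , Y⊆B) E =
      indepᴱ , (λ t → SF.InSpan-trans {w = Y} (family⊆B t) B⊆Y) , (λ t → SF.InSpan-trans {w = family} (Y⊆B t) spans)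
      where
      open IF.IndependentExtension E renaming (indep to indepᴱ)
      family⊆B : LF.SubSpan family B
      family⊆B t with source t
      ... | inj₁ (c , E≡C) = coords c , λ j → F.reflexive (≡.cong (λ v → v j) E≡C)
      ... | inj₂ (b , E≡B) = SF.δ b , λ j → F.trans (F.reflexive (≡.cong (λ v → v j) E≡B)) (F.sym (SF.δ-∑ B b j))

    critical⇒¬partialTransversal : ∀ {s} {Y : Fin s → LF.Vect n} → LF.IsBasisOf B Y → ¬ PartialTransversal L Y
    critical⇒¬partialTransversal B-basis PT = unmatchable
      (IF.extendIndependent C B (SF.lincomb-indep coords B indep (proj₁ B-basis)))
      where
      unmatchable : ¬ IF.IndependentExtension C B
      unmatchable E with PT _ _ (extension-basis B-basis E)
      ... | π , π-injective , π∉ = extension-not-matchable E π π-injective π∉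

  dependent⇒critical : ∀ {d} {B : Fin d → LF.Vect n} → IK.Dependent (imageOf ∘ B) → Critical L B 1
  dependent⇒critical {B = B} (a , agB≈0 , i , ai≉0) = critical B (λ _ → a) indep₁ (λ _ → agB≈0)
    where
    indep₁ : LK.LinIndep {1} (λ _ → a)
    indep₁ x xa≈0 zero = FieldProperties.field-cancel K.field′ ai≉0
      (K.trans (K.*-comm (a i) (x zero)) (K.trans (K.sym (K.+-identityʳ _)) (xa≈0 i)))

  partialTransversal⇒indep : ∀ {s d} {Y : Fin s → LF.Vect n} {B : Fin d → LF.Vect n} →
    PartialTransversal L Y → LF.IsBasisOf B Y → LK.LinIndep (imageOf ∘ B)
  partialTransversal⇒indep {B = B} PT B-basis = decide (IK.indep? (imageOf ∘ B))
    where
    decide : IK.Dependent (imageOf ∘ B) ⊎ LK.LinIndep (imageOf ∘ B) → LK.LinIndep (imageOf ∘ B)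
    decide (inj₂ gB-indep) = gB-indep
    decide (inj₁ gB-dep)   = ⊥-elim (critical⇒¬partialTransversal (dependent⇒critical gB-dep) B-basis PT)

  -- One greedy selection of independent columns of `G Xᵀ` attains both maxima. The selected rows of
  -- `X` span a partial transversal; any partial transversal inside `X`, and any other independent
  -- columns, give independent vectors in the span of the selection, so `steinitz` bounds both.
  rank : ∀ p (X : Fin p → LF.Vect n) → ∃ λ r → QTRank L X r × LK.MatRank (λ i t → imageOf (X t) i) r
  rank p X = fromSelection (IK.extendIndependent []ᵛ (imageOf ∘ X) λ a _ ())
    where
    fromSelection : IK.IndependentExtension []ᵛ (imageOf ∘ X) →
      ∃ λ r → QTRank L X r × LK.MatRank (λ i t → imageOf (X t) i) r
    fromSelection E = r ,
      ( (r , X ∘ σ , (λ t → SF.∈-span X (σ t)) , indep⇒partialTransversal gσ-indep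
          , X ∘ σ , indep-descends gσ-indep , SF.∈-span (X ∘ σ) , SF.∈-span (X ∘ σ))
      , upper )
      , (σ , gσ-indep) , λ s σ′ σ′-indep → IK.steinitz {w = family} σ′-indep (spans ∘ σ′)
      where
      open IK.IndependentExtension E renaming (size to r)
      -- The family being extended is empty, so every member comes from the columns.
      chosen : ∀ i → ∃ λ t → family i ≡ imageOf (X t)
      chosen i with source i
      ... | inj₂ t = t
      σ : Fin r → Fin p
      σ i = proj₁ (chosen i)
      gσ-indep : LK.LinIndep (λ i → imageOf (X (σ i)))
      gσ-indep a aX≈0 = indep a λ j →
        K.trans (SK.∑-cong λ i → K.*-congˡ (K.reflexive (≡.cong (λ v → v j) (proj₂ (chosen i))))) (aX≈0 j)
      upper : ∀ s (Y : Fin s → LF.Vect n) d →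
        LF.SubSpan Y X → PartialTransversal L Y → LF.HasDim Y d → d ≤ r
      upper s Y d Y⊆X PT (B , B-basis) = IK.steinitz {w = family} (partialTransversal⇒indep PT B-basis)
        λ b → SK.InSpan-trans {w = family} (imageOf-InSpan (SF.InSpan-trans {w = X} (proj₁ (proj₂ B-basis) b) Y⊆X)) spans

theorem26 : ∀ {c ℓ : Level} (F : FiniteField c ℓ) (n k : ℕ) (L : Fin k → Subset n) →
    Representable F n (QTransversal.QTRank F L)
theorem26 F n k L = K.field′ , ι , ι-hom , ι-injective , k , G , rank
  where
  gen = Genericity.generic (discrete F) n L
  open Genericity.Generic gen
  open Representation F L gen
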